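{- Let $n\ge 2$. Let $\alpha_S,\alpha_L,\beta_E$ be nonnegative integers with $\alpha_S+\alpha_L>0$, and put $\beta_D=2(\alpha_S+\alpha_L)-1$. Let $W_s$ be a word over the alphabet $\{D,E\}$ with exactly $\beta_D$ letters $D$ and $\beta_E$ letters $E$, and let $W_c$ be a word over $\{S,L\}$ with exactly $\alpha_S$ letters $S$ and $\alpha_L$ letters $L$. Suppose $2\beta_E+3\alpha_S+4\alpha_L=n+1$ (i.e., $(W_s,W_c)$ is a feasible pair). Then the pair defines a ticker tape: there is an independent set of $\mathcal{C}_n$ whose ticker tape has slither $W_s$ and co-slither $W_c$ (as words up to cyclic shift).
   Context: Let $\mathcal{C}_n$ be the cycle graph with vertex set $\mathbb{Z}_n=\{1,\dots,n\}$ and edges $\{i,i+1\}$ (indices mod $n$, so $\{n,1\}$ is an edge). An independent set is written as a binary vector $x=(x_1,\dots,x_n)\in\{0,1\}^n$ with no two cyclically adjacent entries equal to $1$. For $k\in[n]$, the toggle $\tau_k$ changes $x_k$ from $1$ to $0$; changes $x_k$ from $0$ to $1$ if the result is still independent; and otherwise does nothing. Let $\tau=\tau_n\circ\cdots\circ\tau_1$ (a bijection on independent sets), and $x^{(i)}=\tau^i(x)$ for $i\in\mathbb{Z}$. The scroll of $x$ is the array $X_{i,j}$ ($i\in\mathbb{Z}$, $j\in\{1,\dots,n\}$) with $X_{i,j}$ the $j$-th entry of $x^{(i)}$; the ticker tape is the bi-infinite sequence $(X_k)_{k\in\mathbb{Z}}$ with $X_{in+j}=X_{i,j}$. Positions $k$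 with $X_k=1$ are live. The successor $s$ sends a live $k$ to the unique live element of $\{k+2,k+n+1\}$; the co-successor $c$ sends a live $k$ to the unique live element of $\{k+2n-2,k+2n-1\}$; both are bijections on live entries. Snakes are the orbits of $s$ and co-snakes the orbits of $c$; let $\alpha$ be the number of snakes and $\beta$ the number of co-snakes. A step $k\to s(k)$ has type $E$ if $s(k)=k+2$ and type $D$ if $s(k)=k+n+1$; a step $k\to c(k)$ has type $S$ if $c(k)=k+2n-1$ and type $L$ if $c(k)=k+2n-2$. The slither from a live $k$ is the word of step types of $k\to s(k)\to\dots\to s^{\beta}(k)$; the co-slither from $k$ is the word of step types of $k\to c(k)\to\dots\to c^{\alpha}(k)$. Up to cyclic shift these do not depend on $k$ and are called the slither and co-slither of the ticker tape. -}

module Defs where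

open import Data.Bool using (Bool; true; false; _∧_; if_then_else_)
open import Data.Bool.Properties using () renaming (_≟_ to _≟ᴮ_)
open import Data.Nat as ℕ using (ℕ; zero; suc; NonZero)
open import Data.Nat.DivMod using (_%_; m%n<n)
open import Data.Integer as ℤ using (ℤ; +_; _/ℕ_; _%ℕ_)
open import Data.Integer.DivMod using (n%ℕd<d)
open import Data.Fin using (Fin; toℕ; fromℕ<; _≟_)
open import Data.Fin.Properties using (all?)
open import Data.List using (List; []; _∷_; _++_; foldl; allFin; length)
open import Data.Product using (Σ; ∃; ∃-syntax; _×_; _,_)
open import Data.Sum using (_⊎_)
open import Relation.Nullary using (does)
open import Relation.Binary.PropositionalEquality using (_≡_)

-- The cycle graph C_n on vertices Fin n (vertex j+1 of the paper is j here).

next : ∀ {n} .{{_ : NonZero n}} → Fin n → Fin n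
next {n} j = fromℕ< (m%n<n (suc (toℕ j)) n)

BinVec : ℕ → Set
BinVec n = Fin n → Bool

Independent : ∀ {n} .{{_ : NonZero n}} → BinVec n → Set
Independent x = ∀ j → (x j ∧ x (next j)) ≡ false

set : ∀ {n} → BinVec n → Fin n → Bool → BinVec n
set x k b j = if does (j ≟ k) then b else x j

toggle : ∀ {n} .{{_ : NonZero n}} → Fin n → BinVec n → BinVec n
toggle k x =
  if x k then set x k false
  else (if does (all? (λ j → (set x k true j ∧ set x k true (next j)) ≟ᴮ false))
        then set x k true else x)

tau : ∀ {n} .{{_ : NonZero n}} → BinVec n → BinVec n
tau {n} x = foldl (λ y k → toggle k y) x (allFin n)

-- X is the scroll of x : X i = τ^i(x) for all i ∈ ℤ
-- (stated pointwise as X 0 = x and X (i+1) = τ (X i) for every i ∈ ℤ)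
IsScroll : ∀ {n} .{{_ : NonZero n}} → BinVec n → (ℤ → BinVec n) → Set
IsScroll x X = (∀ j → X (+ 0) j ≡ x j) × (∀ i j → X (i ℤ.+ + 1) j ≡ tau (X i) j)

-- the ticker tape: position i*n + j (j ∈ {0,…,n-1}) holds X_{i,j}
-- (paper's 1-based index i*n + (j+1) is shifted by one; all notions below
-- only depend on differences of positions)
Tape : ∀ {n} .{{_ : NonZero n}} → (ℤ → BinVec n) → ℤ → Bool
Tape {n} X k = X (k /ℕ n) (fromℕ< (n%ℕd<d k n))

Live : (ℤ → Bool) → ℤ → Set
Live T k = T k ≡ true

data SType : Set where
  E D : SType

data CType : Set where
  S L : CType

SStep : ℕ → (ℤ → Bool) → ℤ → SType → ℤ → Set
SStep n T k E k' = (k' ≡ k ℤ.+ + 2) × T (k ℤ.+ + 2) ≡ true × T (k ℤ.+ + (n ℕ.+ 1)) ≡ false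
SStep n T k D k' = (k' ≡ k ℤ.+ + (n ℕ.+ 1)) × T (k ℤ.+ + 2) ≡ false × T (k ℤ.+ + (n ℕ.+ 1)) ≡ true

CStep : ℕ → (ℤ → Bool) → ℤ → CType → ℤ → Set
CStep n T k S k' = (k' ≡ k ℤ.+ + (2 ℕ.* n ℕ.∸ 1)) × T (k ℤ.+ + (2 ℕ.* n ℕ.∸ 1)) ≡ true × T (k ℤ.+ + (2 ℕ.* n ℕ.∸ 2)) ≡ false
CStep n T k L k' = (k' ≡ k ℤ.+ + (2 ℕ.* n ℕ.∸ 2)) × T (k ℤ.+ + (2 ℕ.* n ℕ.∸ 1)) ≡ false × T (k ℤ.+ + (2 ℕ.* n ℕ.∸ 2)) ≡ true

data Path {A : Set} (Step : ℤ → A → ℤ → Set) : ℤ → List A → ℤ → Set where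
  done : ∀ {k} → Path Step k [] k
  step : ∀ {k t k₁ w k'} → Step k t k₁ → Path Step k₁ w k' → Path Step k (t ∷ w) k'

-- k and k' lie in the same orbit of the (bijective) step map
SameOrbit : {A : Set} → (ℤ → A → ℤ → Set) → ℤ → ℤ → Set
SameOrbit Step k k' = (∃[ w ] Path Step k w k') ⊎ (∃[ w ] Path Step k' w k)

NumOrbits : {A : Set} → (ℤ → Bool) → (ℤ → A → ℤ → Set) → ℕ → Set
NumOrbits T Step m =
  Σ (Fin m → ℤ) λ rep →
    (∀ i → Live T (rep i)) ×
    (∀ i i' → SameOrbit Step (rep i) (rep i') → i ≡ i') ×
    (∀ k → Live T k → ∃[ i ] SameOrbit Step (rep i) k)

NumSnakes : ℕ → (ℤ → Bool) → ℕ → Set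
NumSnakes n T = NumOrbits T (SStep n T)

NumCoSnakes : ℕ → (ℤ → Bool) → ℕ → Set
NumCoSnakes n T = NumOrbits T (CStep n T)

IsRotation : {A : Set} → List A → List A → Set
IsRotation u v = ∃[ p ] ∃[ q ] (u ≡ p ++ q × v ≡ q ++ p)

HasSlither : ℕ → (ℤ → Bool) → List SType → Set
HasSlither n T W =
  ∃[ β ] (NumCoSnakes n T β ×
    (∀ k → Live T k → ∃[ w ] ∃[ k' ] (length w ≡ β × Path (SStep n T) k w k' × IsRotation w W)))

HasCoSlither : ℕ → (ℤ → Bool) → List CType → Set
HasCoSlither n T W =
  ∃[ α ] (NumSnakes n T α ×
    (∀ k → Live T k → ∃[ w ] ∃[ k' ] (length w ≡ α × Path (CStep n T) k w k' × IsRotation w W)))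

countE countD : List SType → ℕ
countE [] = 0
countE (E ∷ w) = suc (countE w)
countE (D ∷ w) = countE w
countD [] = 0
countD (E ∷ w) = countD w
countD (D ∷ w) = suc (countD w)

countS countL : List CType → ℕ
countS [] = 0
countS (S ∷ w) = suc (countS w)
countS (L ∷ w) = countS w
countL [] = 0
countL (S ∷ w) = countL w
countL (L ∷ w) = suc (countL w)

{-# OPTIONS --safe #-}
module Submission where

-- Let P(a) and Q(b) be the positions reached from 0 by a letters of W_s and by b
-- letters of W_c, both words being repeated periodically.  In a feasible pair they
-- have the same total length M, and the live set is {P(a) + Q(b) - y M}.
-- Two live positions never differ by 1, n - 1 or n: modulo n + 1 the letters D, E,
-- S, L have lengths 0, 2, -3, -4, and feasibility bounds the residues that can
-- accumulate over less than a period.  Conversely the translates of the live set by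
-- 0, 1, n - 1 and n cover the integers, because their union contains 0, has period
-- M and is closed under k ↦ k + 1.  Together these say that k + n is live exactly when
-- none of k, k + 1, k + n - 1 is, which is the rule by which τ writes the tape.
-- Snakes are then indexed by b mod α and co-snakes by a mod β.

open import Defs
open import Data.Nat
open import Data.Nat.Properties
open import Data.Nat.DivMod using (_%_; _/_; m%n<n; m≡m%n+[m/n]*n; m<n⇒m%n≡m; n%n≡0)
open import Data.Nat.ListAction using (sum)
open import Data.Nat.ListAction.Properties using (sum-++)
open import Data.Nat.Tactic.RingSolver using (solve-∀)
import Data.Integer as ℤ
open import Data.Integer using (ℤ; +_; -[1+_]; _/ℕ_; _%ℕ_)
open import Data.Integer.DivMod using (n%ℕd<d; a≡a%ℕn+[a/ℕn]*n)
import Data.Integer.Properties as ℤ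
import Data.Integer.Tactic.RingSolver as ℤSolver
open import Algebra.Properties.AbelianGroup ℤ.+-0-abelianGroup using (∙-cancelʳ)
open import Data.Bool using (Bool; true; false; _∧_; if_then_else_)
open import Data.Bool.Properties using (∧-zeroʳ) renaming (_≟_ to _≟ᴮ_)
open import Data.Fin as Fin using (Fin; toℕ; fromℕ<)
open import Data.Fin.Properties using (toℕ-fromℕ<; toℕ<n; toℕ-injective; all?)
open import Data.List using (List; []; _∷_; _++_; [_]; length; map; foldl; tabulate)
open import Data.List.Properties using (++-assoc; ++-identityʳ; map-++; length-++)
open import Data.Product using (∃-syntax; _×_; _,_)
open import Data.Sum using (_⊎_; inj₁; inj₂)
open import Function using (_∘_; id)
open import Relation.Binary.Definitions using (tri<; tri≈; tri>)
open import Relation.Binary.PropositionalEquality hiding ([_])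
open import Relation.Nullary using (¬_; Dec; contradiction; yes; no; does)
open import Relation.Nullary.Decidable using (dec-true; dec-false)

private variable
  A : Set

-- Weights and rotations of words

total : (A → ℕ) → List A → ℕ
total φ w = sum (map φ w)

total-++ : (φ : A → ℕ) (u v : List A) → total φ (u ++ v) ≡ total φ u + total φ v
total-++ φ u v = trans (cong sum (map-++ φ u v)) (sum-++ (map φ u) (map φ v))

*-length≤total : (φ : A → ℕ) {c : ℕ} → (∀ x → c ≤ φ x) → ∀ w → c * length w ≤ total φ w
*-length≤total φ {c} c≤φ []      = ≤-reflexive (*-zeroʳ c)
*-length≤total φ {c} c≤φ (x ∷ w) =
  ≤-trans (≤-reflexive (*-suc c (length w))) (+-mono-≤ (c≤φ x) (*-length≤total φ c≤φ w))

total≤*-length : (φ : A → ℕ) {c : ℕ} → (∀ x → φ x ≤ c) → ∀ w → total φ w ≤ c * length w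
total≤*-length φ {c} φ≤c []      = z≤n
total≤*-length φ {c} φ≤c (x ∷ w) =
  ≤-trans (+-mono-≤ (φ≤c x) (total≤*-length φ φ≤c w)) (≤-reflexive (sym (*-suc c (length w))))

rotate : List A → List A
rotate []       = []
rotate (x ∷ xs) = xs ++ [ x ]

total-rotate : (φ : A → ℕ) (w : List A) → total φ (rotate w) ≡ total φ w
total-rotate φ []       = refl
total-rotate φ (x ∷ xs) = begin
  total φ (xs ++ [ x ])      ≡⟨ total-++ φ xs [ x ] ⟩
  total φ xs + (φ x + 0)     ≡⟨ cong (λ o → total φ xs + o) (+-identityʳ (φ x)) ⟩
  total φ xs + φ x           ≡⟨ +-comm (total φ xs) (φ x) ⟩
  φ x + total φ xs           ∎
  where open ≡-Reasoning

length-rotate : (w : List A) → length (rotate w) ≡ length w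
length-rotate []       = refl
length-rotate (x ∷ xs) = trans (length-++ xs) (+-comm (length xs) 1)

rotate-isRotation : {u w : List A} → IsRotation u w → IsRotation (rotate u) w
rotate-isRotation ([]     , []    , refl , refl) = [] , [] , refl , refl
rotate-isRotation ([]     , x ∷ q , refl , refl) =
  q , [ x ] , refl , cong (x ∷_) (++-identityʳ q)
rotate-isRotation (x ∷ p , q     , refl , refl) =
  p , q ++ [ x ] , ++-assoc p q [ x ] , sym (++-assoc q [ x ] p)

-- Periodic repetition of a word

-- Giving the first letter separately makes the word nonempty: `period` is visibly a successor, as
-- `_%_` and `_/_` require, and `headOr` has a default, never reached because every `rotated a` has
-- length `period`.
module PeriodicWord {A : Set} (x₀ : A) (W′ : List A) where

  W : List A
  W = x₀ ∷ W′

  period : ℕ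
  period = length W

  rotated : ℕ → List A
  rotated zero    = W
  rotated (suc a) = rotate (rotated a)

  headOr : List A → A
  headOr []      = x₀
  headOr (x ∷ _) = x

  letter : ℕ → A
  letter a = headOr (rotated a)

  factor : ℕ → ℕ → List A
  factor a zero    = []
  factor a (suc m) = letter a ∷ factor (suc a) m

  length-factor : ∀ a m → length (factor a m) ≡ m
  length-factor a zero    = refl
  length-factor a (suc m) = cong suc (length-factor (suc a) m)

  factor-+ : ∀ a m k → factor a (m + k) ≡ factor a m ++ factor (a + m) k
  factor-+ a zero    k rewrite +-identityʳ a = refl
  factor-+ a (suc m) k rewrite +-suc a m = cong (letter a ∷_) (factor-+ (suc a) m k)

  length-rotated : ∀ a → length (rotated a) ≡ period
  length-rotated zero    = refl
  length-rotated (suc a) = trans (length-rotate (rotated a)) (length-rotated a)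

  rotated-isRotation : ∀ a → IsRotation (rotated a) W
  rotated-isRotation zero    = [] , W , refl , sym (++-identityʳ W)
  rotated-isRotation (suc a) = rotate-isRotation (rotated-isRotation a)

  -- Rotation sends the letter just read to the back, so the rest of `u` heads the next rotation.
  -- The remainder `v` is arbitrary because it grows at each step.
  factor-prefix : ∀ u v a → rotated a ≡ u ++ v → factor a (length u) ≡ u
  factor-prefix []      v a eq = refl
  factor-prefix (x ∷ u) v a eq = cong₂ _∷_ (cong headOr eq)
    (factor-prefix u (v ++ [ x ]) (suc a) (trans (cong rotate eq) (++-assoc u v [ x ])))

  factor-period : ∀ a → factor a period ≡ rotated a
  factor-period a = subst (λ p → factor a p ≡ rotated a) (length-rotated a)
    (factor-prefix (rotated a) [] a (sym (++-identityʳ (rotated a))))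

  module _ (φ : A → ℕ) where

    prefix : ℕ → ℕ
    prefix a = total φ (factor 0 a)

    prefix-+ : ∀ a m → prefix (a + m) ≡ prefix a + total φ (factor a m)
    prefix-+ a m = trans (cong (total φ) (factor-+ 0 a m)) (total-++ φ (factor 0 a) _)

    total-rotated : ∀ a → total φ (rotated a) ≡ total φ W
    total-rotated zero    = refl
    total-rotated (suc a) = trans (total-rotate φ (rotated a)) (total-rotated a)

    total-period : ∀ a → total φ (factor a period) ≡ total φ W
    total-period a = trans (cong (total φ) (factor-period a)) (total-rotated a)

    prefix-suc : ∀ a → prefix (suc a) ≡ prefix a + φ (letter a)
    prefix-suc a = begin
      prefix (suc a)                 ≡⟨ cong prefix (+-comm 1 a) ⟩
      prefix (a + 1)                 ≡⟨ prefix-+ a 1 ⟩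
      prefix a + (φ (letter a) + 0)  ≡⟨ cong (λ o → prefix a + o) (+-identityʳ _) ⟩
      prefix a + φ (letter a)        ∎
      where open ≡-Reasoning

    prefix-period : ∀ a → prefix (a + period) ≡ prefix a + total φ W
    prefix-period a = trans (prefix-+ a period) (cong (λ o → prefix a + o) (total-period a))

    prefix-periods : ∀ a q → prefix (a + q * period) ≡ prefix a + q * total φ W
    prefix-periods a zero    = trans (cong prefix (+-identityʳ a)) (sym (+-identityʳ _))
    prefix-periods a (suc q) = begin
      prefix (a + (period + q * period))           ≡⟨ cong prefix (+-assoc a period _) ⟨
      prefix (a + period + q * period)             ≡⟨ prefix-periods (a + period) q ⟩
      prefix (a + period) + q * total φ W          ≡⟨ cong (_+ q * total φ W) (prefix-period a) ⟩
      prefix a + total φ W + q * total φ W         ≡⟨ +-assoc (prefix a) _ _ ⟩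
      prefix a + (total φ W + q * total φ W)       ∎
      where open ≡-Reasoning

    -- A factor shorter than the period misses at least one of its letters, and that letter weighs
    -- at least `c`.
    total-factor-< : ∀ {c} → (∀ x → c ≤ φ x) → ∀ a {m} → m < period →
      total φ (factor a m) + c ≤ total φ W
    total-factor-< {c} c≤φ a {m} m<p with m≤n⇒∃[o]m+o≡n m<p
    ... | o , eq = begin
      total φ (factor a m) + c                                ≤⟨ +-monoʳ-≤ _ (≤-trans (c≤φ _) (m≤m+n _ _)) ⟩
      total φ (factor a m) + total φ (factor (a + m) (suc o)) ≡⟨ total-++ φ (factor a m) _ ⟨
      total φ (factor a m ++ factor (a + m) (suc o))          ≡⟨ cong (total φ) (factor-+ a m (suc o)) ⟨
      total φ (factor a (m + suc o))                          ≡⟨ cong (total φ ∘ factor a) (trans (+-suc m o) eq) ⟩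
      total φ (factor a period)                               ≡⟨ total-period a ⟩
      total φ W                                               ∎
      where open ≤-Reasoning

    total-factor-≤ : ∀ a {m} → m ≤ period → total φ (factor a m) ≤ total φ W
    total-factor-≤ a {m} m≤p with m≤n⇒∃[o]m+o≡n m≤p
    ... | c , eq = begin
      total φ (factor a m)                              ≤⟨ m≤m+n _ _ ⟩
      total φ (factor a m) + total φ (factor (a + m) c) ≡⟨ total-++ φ (factor a m) _ ⟨
      total φ (factor a m ++ factor (a + m) c)          ≡⟨ cong (total φ) (factor-+ a m c) ⟨
      total φ (factor a (m + c))                        ≡⟨ cong (total φ ∘ factor a) eq ⟩
      total φ (factor a period)                         ≡⟨ total-period a ⟩
      total φ W                                         ∎
      where open ≤-Reasoning

    total-factor-≥ : ∀ a {m} → period ≤ m → total φ W ≤ total φ (factor a m)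
    total-factor-≥ a {m} p≤m with m≤n⇒∃[o]m+o≡n p≤m
    ... | c , refl = begin
      total φ W                                          ≡⟨ total-period a ⟨
      total φ (factor a period)                          ≤⟨ m≤m+n _ _ ⟩
      total φ (factor a period) + total φ (factor (a + period) c)
                                                         ≡⟨ total-++ φ (factor a period) _ ⟨
      total φ (factor a period ++ factor (a + period) c) ≡⟨ cong (total φ) (factor-+ a period c) ⟨
      total φ (factor a m)                               ∎
      where open ≤-Reasoning

  -- Orbits of a step map that reads a periodic word

  -- The pattern common to snakes and co-snakes: in `g i a y`, `i` names the orbit, `a` counts steps
  -- along it and `y` counts periods taken back, so that natural numbers also reach what precedes
  -- the representative `g i 0 0`.
  module Orbits (Step : ℤ → A → ℤ → Set) (T : ℤ → Bool)
    {r : ℕ} (g : Fin r → ℕ → ℕ → ℤ)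
    (live : ∀ i a y → Live T (g i a y))
    (covers : ∀ k → Live T k → ∃[ i ] ∃[ a ] ∃[ y ] k ≡ g i a y)
    (advance : ∀ i a y → Step (g i a y) (letter a) (g i (suc a) y))
    (deterministic : ∀ {k t k′ t′ k″} → Step k t k′ → Step k t′ k″ → k′ ≡ k″)
    (wrap : ∀ i a y → g i (a + period) (suc y) ≡ g i a y)
    (separated : ∀ i a i′ → g i a 0 ≡ g i′ 0 0 → i ≡ i′)
    where

    path : ∀ i a y m → Path Step (g i a y) (factor a m) (g i (a + m) y)
    path i a y zero    rewrite +-identityʳ a = done
    path i a y (suc m) rewrite +-suc a m = step (advance i a y) (path i (suc a) y m)

    -- Determinism makes every path follow `advance`, so its endpoint depends on its length alone.
    path-end : ∀ i a y {w k} → Path Step (g i a y) w k → k ≡ g i (a + length w) y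
    path-end i a y done rewrite +-identityʳ a = refl
    path-end i a y (step {w = w} st p) with deterministic st (advance i a y)
    ... | refl rewrite +-suc a (length w) = path-end i (suc a) y p

    wraps : ∀ i a y → g i (a + y * period) y ≡ g i a 0
    wraps i a zero    = cong (λ b → g i b 0) (+-identityʳ a)
    wraps i a (suc y) = begin
      g i (a + (period + y * period)) (suc y)
        ≡⟨ cong (λ b → g i b (suc y)) (trans (cong (λ o → a + o) (+-comm period _)) (sym (+-assoc a _ period))) ⟩
      g i (a + y * period + period) (suc y)    ≡⟨ wrap i _ y ⟩
      g i (a + y * period) y                   ≡⟨ wraps i a y ⟩
      g i a 0                                  ∎
      where open ≡-Reasoning

    numOrbits : NumOrbits T Step r
    numOrbits = rep , (λ i → live i 0 0) , distinct , reached
      where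
      rep : Fin r → ℤ
      rep i = g i 0 0

      distinct : ∀ i i′ → SameOrbit Step (rep i) (rep i′) → i ≡ i′
      distinct i i′ (inj₁ (w , p)) = separated i (length w) i′ (sym (path-end i 0 0 p))
      distinct i i′ (inj₂ (w , p)) = sym (separated i′ (length w) i (sym (path-end i′ 0 0 p)))

      reached : ∀ k → Live T k → ∃[ i ] SameOrbit Step (rep i) k
      reached k lk with covers k lk
      -- By `wraps`, the representative is also step `y * period` at level `y`. If `a` lies beyond
      -- that step, a path leads from the representative to `k`; otherwise one leads from `k` to it.
      ... | i , a , y , refl with ≤-total (y * period) a
      ... | inj₁ le = let c , eq = m≤n⇒∃[o]m+o≡n le in
        i , inj₁ (factor 0 c , subst (Path Step (rep i) (factor 0 c))
          (trans (sym (wraps i c y)) (cong (λ b → g i b y) (trans (+-comm c _) eq)))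
          (path i 0 0 c))
      ... | inj₂ ge = let c , eq = m≤n⇒∃[o]m+o≡n ge in
        i , inj₂ (factor a c , subst (Path Step (g i a y) (factor a c))
          (trans (cong (λ b → g i b y) eq) (wraps i 0 y))
          (path i a y c))

    readings : ∀ k → Live T k →
      ∃[ w ] ∃[ k′ ] (length w ≡ period × Path Step k w k′ × IsRotation w W)
    readings k lk with covers k lk
    ... | i , a , y , refl =
      factor a period , g i (a + period) y , length-factor a period , path i a y period ,
      subst (λ w → IsRotation w W) (sym (factor-period a)) (rotated-isRotation a)

-- From local rules on a tape to a scroll

-- When the vertex at position k is toggled, k holds its old value, k + 1 the old value of its next
-- neighbour, k + n - 1 the new value of its previous neighbour, and k + n its own new value.
module TickerTape (n : ℕ) .{{_ : NonZero n}} (2≤n : 2 ≤ n) (T : ℤ → Bool)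
  (sparse : ∀ k → T k ≡ true → T (k ℤ.+ + 1) ≡ false)
  (sparseₙ₋₁ : ∀ k → T (k ℤ.+ + n) ≡ true → T (k ℤ.+ + 1) ≡ false)
  (sparseₙ : ∀ k → T k ≡ true → T (k ℤ.+ + n) ≡ false)
  (maximal : ∀ k → T k ≡ false → T (k ℤ.+ + 1) ≡ false → T (k ℤ.+ + (n ∸ 1)) ≡ false →
    T (k ℤ.+ + n) ≡ true)
  where

  row : ℤ → BinVec n
  row i j = T (i ℤ.* + n ℤ.+ + toℕ j)

  Tape-row : ∀ k → Tape row k ≡ T k
  Tape-row k = cong T (begin
    (k /ℕ n) ℤ.* + n ℤ.+ + toℕ (fromℕ< (n%ℕd<d k n)) ≡⟨ cong (λ r → (k /ℕ n) ℤ.* + n ℤ.+ + r) (toℕ-fromℕ< _) ⟩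
    (k /ℕ n) ℤ.* + n ℤ.+ + (k %ℕ n)                  ≡⟨ ℤ.+-comm ((k /ℕ n) ℤ.* + n) _ ⟩
    + (k %ℕ n) ℤ.+ (k /ℕ n) ℤ.* + n                  ≡⟨ a≡a%ℕn+[a/ℕn]*n k n ⟨
    k                                               ∎)
    where open ≡-Reasoning

  data NextView (j : Fin n) : Set where
    inner : toℕ (next j) ≡ suc (toℕ j) → NextView j
    outer : suc (toℕ j) ≡ n → toℕ (next j) ≡ 0 → NextView j

  nextView : ∀ j → NextView j
  nextView j with m≤n⇒m<n∨m≡n (toℕ<n j)
  ... | inj₁ lt = inner (trans (toℕ-fromℕ< _) (m<n⇒m%n≡m lt))
  ... | inj₂ eq = outer eq (trans (toℕ-fromℕ< _) (trans (cong (_% n) eq) (n%n≡0 n)))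

  previous : ∀ k → ∃[ j ] next j ≡ k
  previous k with toℕ k in eq
  ... | zero  = fromℕ< last<n , toℕ-injective (trans zero≡ (sym eq))
    where
    last<n : n ∸ 1 < n
    last<n = ∸-monoʳ-< z<s (≤-trans (s≤s z≤n) 2≤n)
    zero≡ : toℕ (next (fromℕ< last<n)) ≡ 0
    zero≡ = trans (toℕ-fromℕ< _) (trans (cong (_% n)
      (trans (cong suc (toℕ-fromℕ< last<n)) (m+[n∸m]≡n (≤-trans (s≤s z≤n) 2≤n)))) (n%n≡0 n))
  ... | suc m = fromℕ< m<n , toℕ-injective (trans (toℕ-fromℕ< _)
      (trans (m<n⇒m%n≡m (subst (_< n) (cong suc (sym (toℕ-fromℕ< m<n))) m+1<n))
        (trans (cong suc (toℕ-fromℕ< m<n)) (sym eq))))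
    where
    m+1<n : suc m < n
    m+1<n = subst (_< n) eq (toℕ<n k)
    m<n : m < n
    m<n = <-trans (n<1+n m) m+1<n

  next≢ : ∀ j → next j ≢ j
  next≢ j eq with nextView j
  ... | inner p   = 1+n≢n (trans (sym p) (cong toℕ eq))
  ... | outer p q = contradiction (subst (2 ≤_) (trans (sym p) (cong suc (trans (cong toℕ (sym eq)) q))) 2≤n)
    λ { (s≤s ()) }

  module _ (i : ℤ) where

    private
      at : ℕ → ℤ
      at o = i ℤ.* + n ℤ.+ + o

      at-+ : ∀ o d → at (o + d) ≡ at o ℤ.+ + d
      at-+ o d = sym (ℤ.+-assoc (i ℤ.* + n) (+ o) (+ d))

      at-next-row : ∀ o → at (o + n) ≡ (i ℤ.+ + 1) ℤ.* + n ℤ.+ + o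
      at-next-row o = shift i (+ n) (+ o)
        where
        shift : ∀ i n o → i ℤ.* n ℤ.+ (o ℤ.+ n) ≡ (i ℤ.+ + 1) ℤ.* n ℤ.+ o
        shift = ℤSolver.solve-∀

    -- The row after toggling the first m vertices consists of the entries of
    -- the tape at the n consecutive positions in + m, …, in + m + n - 1.
    record Stage (m : ℕ) (y : BinVec n) : Set where
      field
        toggled   : ∀ j → toℕ j < m → y j ≡ T (at (toℕ j + n))
        untoggled : ∀ j → m ≤ toℕ j → y j ≡ T (at (toℕ j))
    open Stage

    -- In the window of n positions starting at that of `κ`, cyclic neighbours occupy consecutive
    -- positions, with one exception: the edge ending in `κ` joins the last position of the window
    -- to the first.
    data Neighbours (κ : Fin n) (y : BinVec n) (j : Fin n) : Set where
      closing  : next j ≡ κ → y j ≡ T (at (toℕ κ + (n ∸ 1))) → Neighbours κ y j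
      adjacent : next j ≢ κ → ∀ o → y j ≡ T (at o) → y (next j) ≡ T (at (o + 1)) →
        (j ≡ κ → o ≡ toℕ κ) → Neighbours κ y j

    neighbours : ∀ {κ y} → Stage (toℕ κ) y → ∀ j → Neighbours κ y j
    neighbours {κ} {y} st j with nextView j
    neighbours {κ} {y} st j | inner p with <-cmp (suc (toℕ j)) (toℕ κ)
    ... | tri≈ _ eq _ = closing (toℕ-injective (trans p eq))
          (trans (toggled st j (≤-reflexive eq)) (cong (T ∘ at) (trans shift (cong (_+ (n ∸ 1)) eq))))
          where
          shift : toℕ j + n ≡ suc (toℕ j) + (n ∸ 1)
          shift = trans (cong (λ o → toℕ j + o) (sym (m+[n∸m]≡n (≤-trans (s≤s z≤n) 2≤n)))) (+-suc (toℕ j) (n ∸ 1))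
    ... | tri< lt ¬eq _ = adjacent (λ q → ¬eq (trans (sym p) (cong toℕ q))) (toℕ j + n)
          (toggled st j (<-trans (n<1+n _) lt))
          (trans (toggled st (next j) (subst (_< toℕ κ) (sym p) lt))
            (cong (T ∘ at) (trans (cong (_+ n) p) (+-comm 1 (toℕ j + n)))))
          (λ { refl → contradiction lt (<⇒≯ (n<1+n _)) })
    ... | tri> _ ¬eq gt = adjacent (λ q → ¬eq (trans (sym p) (cong toℕ q))) (toℕ j)
          (untoggled st j (s≤s⁻¹ gt))
          (trans (untoggled st (next j) (subst (toℕ κ ≤_) (sym p) (<⇒≤ gt)))
            (cong (T ∘ at) (trans p (+-comm 1 (toℕ j)))))
          (cong toℕ)
    -- The edge from the last vertex to vertex 0. It closes the window if `κ` is 0; otherwise vertex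
    -- 0 has already moved to offset n, right after offset n - 1.
    neighbours {κ} {y} st j | outer p q with toℕ κ in eq
    ... | zero = closing (toℕ-injective (trans q (sym eq)))
          (trans (untoggled st j z≤n) (cong (T ∘ at) (trans (cong (_∸ 1) p) (cong (_+ (n ∸ 1)) (sym eq)))))
    ... | suc m = adjacent (λ r → contradiction (trans (sym q) (trans (cong toℕ r) eq)) λ ()) (toℕ j)
          (untoggled st j (s≤s⁻¹ (subst₂ _≤_ (cong suc eq) (sym p) (toℕ<n κ))))
          (trans (toggled st (next j) (subst (_< suc m) (sym q) z<s))
            (cong (T ∘ at) (trans (cong (_+ n) q) (trans (sym p) (+-comm 1 (toℕ j))))))
          (cong toℕ)

    -- Only the entry of `κ` changes, from position k to k + n. If k is live, the toggle switches it
    -- off and `sparseₙ` makes k + n dead; if k is dead, the toggle succeeds exactly when k + n is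
    -- live.
    toggle-stage : ∀ κ y → Stage (toℕ κ) y → Stage (suc (toℕ κ)) (toggle κ y)
    toggle-stage κ y st = record
      { toggled   = λ j j≤κ → new j (m≤n⇒m<n∨m≡n (s≤s⁻¹ j≤κ))
      ; untoggled = λ j κ<j → trans (elsewhere j (λ { refl → <-irrefl refl κ<j })) (untoggled st j (<⇒≤ κ<j))
      }
      where
      set-at : ∀ b → set y κ b κ ≡ b
      set-at b rewrite dec-true (κ Fin.≟ κ) refl = refl

      set-off : ∀ b {j} → j ≢ κ → set y κ b j ≡ y j
      set-off b {j} j≢κ rewrite dec-false (j Fin.≟ κ) j≢κ = refl

      elsewhere : ∀ j → j ≢ κ → toggle κ y j ≡ y j
      elsewhere j j≢κ with y κ
      ... | true = set-off false j≢κ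
      ... | false with does (all? (λ j → (set y κ true j ∧ set y κ true (next j)) ≟ᴮ false))
      ...   | true  = set-off true j≢κ
      ...   | false = refl

      Free : Set
      Free = ∀ j → (set y κ true j ∧ set y κ true (next j)) ≡ false

      yκ : y κ ≡ T (at (toℕ κ))
      yκ = untoggled st κ ≤-refl

      -- On the closing edge, a live k + n - 1 would kill k + n by `sparse`; on the edge leaving
      -- `κ`, `sparseₙ₋₁` makes k + 1 dead; every other edge is a pair of consecutive positions,
      -- covered by `sparse`.
      live⇒free : T (at (toℕ κ + n)) ≡ true → Free
      live⇒free l j with neighbours st j
      ... | closing refl yj≡ rewrite set-off true {j} (next≢ j ∘ sym) | yj≡
            with T (at (toℕ κ + (n ∸ 1))) in eq
      ...   | false = refl
      ...   | true  = contradiction (trans (sym l) (trans (cong T shift) (sparse _ eq))) λ ()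
            where
            shift : at (toℕ κ + n) ≡ at (toℕ κ + (n ∸ 1)) ℤ.+ + 1
            shift = trans (cong at (trans (cong (λ o → toℕ κ + o) (sym (m∸n+n≡m (≤-trans (s≤s z≤n) 2≤n))))
              (sym (+-assoc (toℕ κ) _ 1)))) (at-+ _ 1)
      live⇒free l j | adjacent nj≢κ o yj≡ ynj≡ o≡ with j Fin.≟ κ
      ... | yes refl = trans (set-off true nj≢κ) (trans ynj≡ (trans (cong T
              (trans (cong (λ o → at (o + 1)) (o≡ refl)) (at-+ _ 1)))
              (sparseₙ₋₁ (at (toℕ κ)) (trans (cong T (sym (at-+ _ n))) l))))
      ... | no j≢κ rewrite set-off true nj≢κ | yj≡ | ynj≡ with T (at o) in eq
      ...   | false = refl
      ...   | true  = trans (cong T (at-+ o 1)) (sparse _ eq)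

      -- Freeness on the two edges at `κ` makes k + 1 and k + n - 1 dead, which is what `maximal`
      -- needs besides a dead k.
      free⇒live : y κ ≡ false → Free → T (at (toℕ κ + n)) ≡ true
      free⇒live yκ≡false free = trans (cong T (at-+ _ n)) (maximal (at (toℕ κ))
          (trans (sym yκ) yκ≡false) right left)
        where
        right : T (at (toℕ κ) ℤ.+ + 1) ≡ false
        right with neighbours st κ
        ... | closing nκ≡κ _ = contradiction nκ≡κ (next≢ κ)
        ... | adjacent nκ≢κ o _ ynκ≡ o≡ = begin
          T (at (toℕ κ) ℤ.+ + 1)                            ≡⟨ cong T (at-+ _ 1) ⟨
          T (at (toℕ κ + 1))                                ≡⟨ cong (λ o → T (at (o + 1))) (o≡ refl) ⟨
          T (at (o + 1))                                    ≡⟨ ynκ≡ ⟨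
          y (next κ)                                        ≡⟨ set-off true nκ≢κ ⟨
          set y κ true (next κ)                             ≡⟨ cong (_∧ set y κ true (next κ)) (set-at true) ⟨
          set y κ true κ ∧ set y κ true (next κ)            ≡⟨ free κ ⟩
          false                                             ∎
          where open ≡-Reasoning
        left : T (at (toℕ κ) ℤ.+ + (n ∸ 1)) ≡ false
        left with previous κ
        ... | j , nj≡κ with neighbours st j
        ...   | adjacent nj≢κ _ _ _ _ = contradiction nj≡κ nj≢κ
        ...   | closing _ yj≡ with free j
        ...     | f rewrite nj≡κ | set-at true
                  | set-off true {j} (λ j≡κ → next≢ j (trans nj≡κ (sym j≡κ))) | yj≡
                  with T (at (toℕ κ + (n ∸ 1))) in eq
        ...       | false = trans (cong T (sym (at-+ _ (n ∸ 1)))) eq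

      here-if : (free? : Dec Free) → y κ ≡ false →
        (if does free? then set y κ true else y) κ ≡ T (at (toℕ κ + n))
      here-if (yes free) eq = trans (set-at true) (sym (free⇒live eq free))
      here-if (no ¬free) eq with T (at (toℕ κ + n)) in l
      ... | true  = contradiction (live⇒free l) ¬free
      ... | false = eq

      here : toggle κ y κ ≡ T (at (toℕ κ + n))
      here with y κ in eq
      ... | true  = trans (set-at false)
            (sym (trans (cong T (at-+ _ n)) (sparseₙ _ (trans (sym yκ) eq))))
      ... | false = here-if (all? (λ j → (set y κ true j ∧ set y κ true (next j)) ≟ᴮ false)) eq

      new : ∀ j → toℕ j < toℕ κ ⊎ toℕ j ≡ toℕ κ → toggle κ y j ≡ T (at (toℕ j + n))
      new j (inj₁ j<κ) = trans (elsewhere j (λ { refl → <-irrefl refl j<κ })) (toggled st j j<κ)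
      new j (inj₂ j≡κ) with toℕ-injective j≡κ
      ... | refl = here

    -- `allFin n` is `tabulate id` and the fold consumes it from the front, so the induction runs
    -- over enumerations `f` of the vertices from `m` on.
    toggles-stage : ∀ {k} m (f : Fin k → Fin n) → (∀ a → toℕ (f a) ≡ m + toℕ a) →
      ∀ y → Stage m y → Stage (m + k) (foldl (λ y κ → toggle κ y) y (tabulate f))
    toggles-stage {zero}  m f fa y st = subst (λ m → Stage m y) (sym (+-identityʳ m)) st
    toggles-stage {suc k} m f fa y st rewrite +-suc m k =
      toggles-stage (suc m) (f ∘ Fin.suc) (λ a → trans (fa (Fin.suc a)) (+-suc m (toℕ a)))
        (toggle (f Fin.zero) y)
        (subst (λ l → Stage (suc l) (toggle (f Fin.zero) y)) f0 (toggle-stage (f Fin.zero) y (subst (λ l → Stage l y) (sym f0) st)))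
      where
      f0 : toℕ (f Fin.zero) ≡ m
      f0 = trans (fa Fin.zero) (+-identityʳ m)

    tau-row : ∀ j → row (i ℤ.+ + 1) j ≡ tau (row i) j
    tau-row j = trans (cong T (sym (at-next-row (toℕ j)))) (sym (toggled
      (toggles-stage 0 id (λ _ → refl) (row i) (record { toggled = λ _ () ; untoggled = λ _ _ → refl }))
      j (toℕ<n j)))

  row-isScroll : IsScroll (row (+ 0)) row
  row-isScroll = (λ _ → refl) , tau-row

  row-independent : Independent (row (+ 0))
  row-independent j with nextView j
  ... | inner p rewrite p with T (+ toℕ j) in eq
  ...   | false = refl
  ...   | true  = trans (cong (T ∘ +_) (+-comm 1 (toℕ j))) (sparse _ eq)
  -- The edge from vertex n - 1 to vertex 0 is `sparseₙ₋₁` taken at position -1.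
  row-independent j | outer p q rewrite q with T (+ 0) in eq
  ... | false = ∧-zeroʳ _
  ... | true  = trans (cong (λ k → T k ∧ true) (trans (unshift (+ toℕ j)) (cong (λ o → ℤ.- + 1 ℤ.+ + o) p)))
    (cong (_∧ true) last)
    where
    unshift : ∀ k → k ≡ ℤ.- + 1 ℤ.+ (+ 1 ℤ.+ k)
    unshift = ℤSolver.solve-∀
    last : T (ℤ.- + 1 ℤ.+ + n) ≡ false
    last with T (ℤ.- + 1 ℤ.+ + n) in l
    ... | false = refl
    ... | true  = contradiction (trans (sym eq) (sparseₙ₋₁ (ℤ.- + 1) l)) λ ()

-- Arithmetic of the distances between live positions

-- For N = n + 1 the middle range ends at n - 2, so with n at least 2 the excluded distances are
-- exactly 1, n - 1 and n.
data Admissible (N δ : ℕ) : Set where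
  null   : δ ≡ 0 → Admissible N δ
  middle : 2 ≤ δ → δ + 3 ≤ N → Admissible N δ
  large  : N ≤ δ → Admissible N δ

-- N d + 2 e is the length of a stretch of snake and 2 N t - B that of a
-- stretch of t co-snake steps; the estimate small holds in a feasible pair.
module Distances {N d e t B : ℕ} (N>0 : 0 < N)
  (3t≤B : 3 * t ≤ B) (B≤4t : B ≤ 4 * t) (B≤N : B ≤ N)
  (small : d ≤ 2 * t → 2 * e + B + 3 ≤ N) where

  private
    R = 2 * e + B

    B-zero : t ≡ 0 → B ≡ 0
    B-zero t≡0 = n≤0⇒n≡0 (subst (λ t → B ≤ 4 * t) t≡0 B≤4t)

    3≤B : 0 < t → 3 ≤ B
    3≤B t>0 = ≤-trans (*-monoʳ-≤ 3 t>0) 3t≤B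

    -- R is never 1: a positive `e` contributes at least 2, a positive `t` at least 3.
    R-admissible : R + 3 ≤ N → Admissible N R
    R-admissible R+3≤N with e ≟ 0 | t ≟ 0
    ... | yes refl | yes t≡0 = null (B-zero t≡0)
    ... | yes refl | no  t≢0 = middle (≤-trans (s≤s (s≤s z≤n)) (3≤B (n≢0⇒n>0 t≢0))) R+3≤N
    ... | no  e≢0  | _       = middle (≤-trans (*-monoʳ-≤ 2 (n≢0⇒n>0 e≢0)) (m≤m+n _ B)) R+3≤N

    large-by : ∀ {δ} x → N + x ≡ δ → Admissible N δ
    large-by x refl = large (m≤m+n N x)

    multiple : ∀ {c x} → N * c ≤ x → x + 3 ≤ N → c ≡ 0
    multiple {zero}  _  _ = refl
    multiple {suc c} {x} le lt = contradiction
      (≤-trans (m≤m*n N (suc c)) le) (<⇒≱ (<-≤-trans (m<m+n x z<s) lt))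

    beyond : ∀ x {c} → 2 * t + suc c ≡ d → N * d + x ≡ N * (2 * t) + (N + (N * c + x))
    beyond x {c} refl = eq N t c x
      where
      eq : ∀ N t c x → N * (2 * t + suc c) + x ≡ N * (2 * t) + (N + (N * c + x))
      eq = solve-∀

    exceeds : ∀ {m k} → m < k → ∃[ o ] m + suc o ≡ k
    exceeds {m} m<k = let o , eq = m≤n⇒∃[o]m+o≡n m<k in o , trans (+-suc m o) eq

    within : ∀ {c} → d + c ≡ 2 * t → N * (2 * t) ≡ N * d + N * c
    within {c} eq = trans (cong (N *_) (sym eq)) (*-distribˡ-+ N d c)

  -- Here δ = N (d - 2 t) + R. If d > 2 t this is at least N; if d ≤ 2 t, then R < N forces d = 2 t
  -- and δ = R.
  behind : ∀ {δ} → N * (2 * t) + δ ≡ N * d + R → Admissible N δ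
  behind {δ} eq with ≤-<-connex d (2 * t)
  ... | inj₂ 2t<d = let c , eq′ = exceeds 2t<d in
    large-by _ (sym (+-cancelˡ-≡ (N * (2 * t)) δ _ (trans eq (beyond R eq′))))
  ... | inj₁ d≤2t with m≤n⇒∃[o]m+o≡n d≤2t
  ... | c , eq′ = subst (Admissible N) R≡δ (R-admissible (small d≤2t))
    where
    gap : N * c + δ ≡ R
    gap = +-cancelˡ-≡ (N * d) (N * c + δ) R
      (trans (sym (+-assoc (N * d) _ δ)) (trans (cong (_+ δ) (sym (within eq′))) eq))
    R≡δ : R ≡ δ
    R≡δ = trans (sym gap) (cong (_+ δ)
      (trans (cong (N *_) (multiple (≤-trans (m≤m+n _ δ) (≤-reflexive gap)) (small d≤2t))) (*-zeroʳ N)))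

  -- If d ≥ 2 t, only δ = 0 is possible. Otherwise δ = N c - R with c = 2 t - d, and c = 0, c = 1, c
  -- ≥ 2 lead to the three kinds of distance.
  ahead : ∀ {δ} → N * d + R + δ ≡ N * (2 * t) → Admissible N δ
  ahead {δ} eq with ≤-total (2 * t) d
  ... | inj₁ 2t≤d = null (m+n≡0⇒n≡0 R (n≤0⇒n≡0 (+-cancelˡ-≤ (N * d) (R + δ) 0 le)))
    where
    le : N * d + (R + δ) ≤ N * d + 0
    le = begin
      N * d + (R + δ) ≡⟨ +-assoc (N * d) R δ ⟨
      N * d + R + δ   ≡⟨ eq ⟩
      N * (2 * t)     ≤⟨ *-monoʳ-≤ N 2t≤d ⟩
      N * d           ≡⟨ +-identityʳ _ ⟨
      N * d + 0       ∎
      where open ≤-Reasoning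
  ... | inj₂ d≤2t with m≤n⇒∃[o]m+o≡n d≤2t
  ... | c , eq′ = split c gap t>0-or-c=0
    where
    gap : R + δ ≡ N * c
    gap = +-cancelˡ-≡ (N * d) (R + δ) (N * c)
      (trans (sym (+-assoc (N * d) R δ)) (trans eq (within eq′)))
    t>0-or-c=0 : t ≡ 0 → c ≡ 0
    t>0-or-c=0 t≡0 = m+n≡0⇒n≡0 d (trans eq′ (cong (2 *_) t≡0))
    R<N : R + 3 ≤ N
    R<N = small d≤2t
    split : ∀ c → R + δ ≡ N * c → (t ≡ 0 → c ≡ 0) → Admissible N δ
    split zero          g _ = null (m+n≡0⇒n≡0 R (trans g (*-zeroʳ N)))
    -- Here δ = N - R: the bound R + 3 ≤ N gives δ ≥ 3, and R ≥ B ≥ 3, valid since `t` is positive,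
    -- gives δ + 3 ≤ N.
    split (suc zero)    g h = middle
      (≤-trans (s≤s (s≤s z≤n)) (+-cancelˡ-≤ R 3 δ (≤-trans R<N (≤-reflexive (sym N≡)))))
      (≤-trans (+-monoʳ-≤ δ (≤-trans (3≤B (n≢0⇒n>0 (λ z → contradiction (h z) λ ()))) (m≤n+m B (2 * e))))
               (≤-reflexive (trans (+-comm δ R) N≡)))
      where
      N≡ : R + δ ≡ N
      N≡ = trans g (*-identityʳ N)
    split (suc (suc c)) g _ = large (+-cancelˡ-≤ N N δ (begin
      N + N             ≤⟨ m≤m+n (N + N) (N * c) ⟩
      N + N + N * c     ≡⟨ distr N c ⟩
      N * suc (suc c)   ≡⟨ g ⟨
      R + δ             ≤⟨ +-monoˡ-≤ δ (≤-trans (m≤m+n R 3) R<N) ⟩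
      N + δ             ∎))
      where
      open ≤-Reasoning
      distr : ∀ N c → N + N + N * c ≡ N * (2 + c)
      distr = solve-∀

  -- Both stretches point the same way. If `t` is positive, B ≤ N leaves at least 2 N - N; if `t` is
  -- 0, then B = 0 and δ = N d + 2 e, which is large unless d = 0.
  beside : ∀ {δ} → δ + B ≡ N * (d + 2 * t) + 2 * e → Admissible N δ
  beside {δ} eq with t ≟ 0 | d ≟ 0
  ... | no t≢0 | _ = large (+-cancelʳ-≤ N N δ (begin
      N + N                       ≡⟨ double N ⟩
      N * (2 * 1)                 ≤⟨ *-monoʳ-≤ N (*-monoʳ-≤ 2 (n≢0⇒n>0 t≢0)) ⟩
      N * (2 * t)                 ≤⟨ *-monoʳ-≤ N (m≤n+m (2 * t) d) ⟩
      N * (d + 2 * t)             ≤⟨ m≤m+n _ (2 * e) ⟩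
      N * (d + 2 * t) + 2 * e     ≡⟨ eq ⟨
      δ + B                       ≤⟨ +-monoʳ-≤ δ B≤N ⟩
      δ + N                       ∎))
      where
      open ≤-Reasoning
      double : ∀ N → N + N ≡ N * 2
      double = solve-∀
  ... | yes t≡0 | no d≢0 = large (begin
      N                           ≡⟨ *-identityʳ N ⟨
      N * 1                       ≤⟨ *-monoʳ-≤ N (≤-trans (n≢0⇒n>0 d≢0) (m≤m+n d (2 * t))) ⟩
      N * (d + 2 * t)             ≤⟨ m≤m+n _ (2 * e) ⟩
      N * (d + 2 * t) + 2 * e     ≡⟨ eq ⟨
      δ + B                       ≡⟨ cong (λ o → δ + o) (B-zero t≡0) ⟩
      δ + 0                       ≡⟨ +-identityʳ δ ⟩
      δ                           ∎)
      where open ≤-Reasoning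
  ... | yes t≡0 | yes refl = subst (Admissible N) R≡δ (R-admissible (small z≤n))
      where
      open ≡-Reasoning
      R≡δ : R ≡ δ
      R≡δ = begin
        2 * e + B                  ≡⟨ cong (λ o → 2 * e + o) (B-zero t≡0) ⟩
        2 * e + 0                  ≡⟨ +-comm (2 * e) 0 ⟩
        2 * e                      ≡⟨ cong (_+ 2 * e) (*-zeroʳ N) ⟨
        N * (2 * 0) + 2 * e        ≡⟨ cong (λ t → N * (2 * t) + 2 * e) t≡0 ⟨
        N * (2 * t) + 2 * e        ≡⟨ eq ⟨
        δ + B                      ≡⟨ cong (λ o → δ + o) (B-zero t≡0) ⟩
        δ + 0                      ≡⟨ +-identityʳ δ ⟩
        δ                          ∎

  -- Equal lengths would make R a multiple of N smaller than N, hence 0, whereas R is at least 3 t.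
  coincident : N * (2 * t) ≡ N * d + R → t ≡ 0
  coincident eq with ≤-<-connex d (2 * t)
  ... | inj₂ 2t<d = contradiction (≤-trans (m≤m+n (N * d) R) (≤-reflexive (sym eq)))
        (<⇒≱ (*-monoʳ-< N {{>-nonZero N>0}} 2t<d))
  ... | inj₁ d≤2t with m≤n⇒∃[o]m+o≡n d≤2t
  ... | c , eq′ = n≤0⇒n≡0 (*-cancelˡ-≤ 3 (≤-trans 3t≤B (≤-trans (m≤n+m B (2 * e)) (≤-reflexive R≡0))))
    where
    gap : N * c ≡ R
    gap = +-cancelˡ-≡ (N * d) (N * c) R (trans (sym (within eq′)) eq)
    R≡0 : R ≡ 0
    R≡0 = trans (sym gap) (trans (cong (N *_) (multiple (≤-reflexive gap) (small d≤2t))) (*-zeroʳ N))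

-- Weights of the letters

isE isD : SType → ℕ
isE E = 1
isE D = 0
isD E = 0
isD D = 1

-- The amount by which a co-snake step, of length 2 n - 1 or 2 n - 2, falls short of 2 (n + 1).
deficit : CType → ℕ
deficit S = 3
deficit L = 4

3≤deficit : ∀ x → 3 ≤ deficit x
3≤deficit S = ≤-refl
3≤deficit L = n≤1+n 3

deficit≤4 : ∀ x → deficit x ≤ 4
deficit≤4 S = n≤1+n 3
deficit≤4 L = ≤-refl

-- Lengths of stretches in a feasible pair

module FeasiblePair (n : ℕ) (2≤n : 2 ≤ n)
  (s₀ : SType) (Ws′ : List SType) (c₀ : CType) (Wc′ : List CType)
  (balance : total isD (s₀ ∷ Ws′) + 1 ≡ 2 * length (c₀ ∷ Wc′))
  (feasible : 2 * total isE (s₀ ∷ Ws′) + total deficit (c₀ ∷ Wc′) ≡ n + 1)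
  where

  module Sn = PeriodicWord s₀ Ws′
  module Co = PeriodicWord c₀ Wc′

  private
    α = Co.period
    β = Sn.period
    N = n + 1

    1≤n : 1 ≤ n
    1≤n = ≤-trans (s≤s z≤n) 2≤n

  lenS : SType → ℕ
  lenS E = 2
  lenS D = n + 1

  lenC : CType → ℕ
  lenC S = 2 * n ∸ 1
  lenC L = 2 * n ∸ 2

  private
    2n-1 : 2 * n ∸ 1 + 1 ≡ 2 * n
    2n-1 = m∸n+n≡m (≤-trans 1≤n (m≤m+n n _))

    2n-2 : 2 * n ∸ 2 + 2 ≡ 2 * n
    2n-2 = m∸n+n≡m (≤-trans 2≤n (m≤m+n n _))

    n-1 : n ∸ 1 + 1 ≡ n
    n-1 = m∸n+n≡m 1≤n

  total-lenS : ∀ w → total lenS w ≡ N * total isD w + 2 * total isE w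
  total-lenS []      = sym (trans (+-identityʳ _) (*-zeroʳ N))
  total-lenS (E ∷ w) = trans (cong (λ o → 2 + o) (total-lenS w)) (eq N (total isD w) (total isE w))
    where
    eq : ∀ N d e → 2 + (N * d + 2 * e) ≡ N * d + 2 * (1 + e)
    eq = solve-∀
  total-lenS (D ∷ w) = trans (cong (λ o → N + o) (total-lenS w)) (eq N (total isD w) (total isE w))
    where
    eq : ∀ N d e → N + (N * d + 2 * e) ≡ N * (1 + d) + 2 * e
    eq = solve-∀

  lenC+deficit : ∀ x → lenC x + deficit x ≡ N * 2
  lenC+deficit S = trans (sym (+-assoc _ 1 2)) (trans (cong (_+ 2) 2n-1) (eq n))
    where
    eq : ∀ n → 2 * n + 2 ≡ (n + 1) * 2
    eq = solve-∀
  lenC+deficit L = trans (sym (+-assoc _ 2 2)) (trans (cong (_+ 2) 2n-2) (eq n))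
    where
    eq : ∀ n → 2 * n + 2 ≡ (n + 1) * 2
    eq = solve-∀

  total-lenC : ∀ w → total lenC w + total deficit w ≡ N * (2 * length w)
  total-lenC []      = sym (*-zeroʳ N)
  total-lenC (x ∷ w) = begin
    lenC x + total lenC w + (deficit x + total deficit w)   ≡⟨ swap (lenC x) _ _ _ ⟩
    lenC x + deficit x + (total lenC w + total deficit w)   ≡⟨ cong₂ _+_ (lenC+deficit x) (total-lenC w) ⟩
    N * 2 + N * (2 * length w)                              ≡⟨ distr N (length w) ⟩
    N * (2 * suc (length w))                                ∎
    where
    open ≡-Reasoning
    swap : ∀ a b c d → a + b + (c + d) ≡ a + c + (b + d)
    swap = solve-∀
    distr : ∀ N l → N * 2 + N * (2 * l) ≡ N * (2 * (1 + l))
    distr = solve-∀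

  M : ℕ
  M = total lenS Sn.W

  -- The two totals are N (2 α - 1) + 2 e and 2 N α - B, with e the number of letters `E` and B the
  -- whole deficit. They agree because feasibility says 2 e + B = N.
  total-lenC-W : total lenC Co.W ≡ M
  total-lenC-W = +-cancelʳ-≡ (total deficit Co.W) _ _ (begin
    total lenC Co.W + B             ≡⟨ total-lenC Co.W ⟩
    N * (2 * α)                     ≡⟨ cong (N *_) balance ⟨
    N * (d + 1)                     ≡⟨ *-distribˡ-+ N d 1 ⟩
    N * d + N * 1                   ≡⟨ cong (λ x → N * d + x) (trans (*-identityʳ N) (sym feasible)) ⟩
    N * d + (2 * e + B)             ≡⟨ +-assoc (N * d) (2 * e) B ⟨
    N * d + 2 * e + B               ≡⟨ cong (_+ B) (total-lenS Sn.W) ⟨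
    M + B                           ∎)
    where
    open ≡-Reasoning
    d = total isD Sn.W
    e = total isE Sn.W
    B = total deficit Co.W

  1≤lenS : ∀ x → 1 ≤ lenS x
  1≤lenS E = s≤s z≤n
  1≤lenS D = m≤n+m 1 n

  M>0 : 0 < M
  M>0 = ≤-trans (1≤lenS s₀) (m≤m+n _ _)

  P Q : ℕ → ℕ
  P = Sn.prefix lenS
  Q = Co.prefix lenC

  P-periods : ∀ a q → P (a + q * β) ≡ P a + q * M
  P-periods = Sn.prefix-periods lenS

  Q-periods : ∀ b q → Q (b + q * α) ≡ Q b + q * M
  Q-periods b q = trans (Co.prefix-periods lenC b q) (cong (λ m → Q b + q * m) total-lenC-W)

  module Stretch (a m b : ℕ) {t : ℕ} (t<α : t < α) where

    private
      u = Sn.factor a m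
      v = Co.factor b t
      d = total isD u
      e = total isE u
      B = total deficit v

      B+3≤ : B + 3 ≤ total deficit Co.W
      B+3≤ = Co.total-factor-< deficit 3≤deficit b t<α

      3t≤B : 3 * t ≤ B
      3t≤B = subst (λ l → 3 * l ≤ B) (Co.length-factor b t) (*-length≤total deficit 3≤deficit v)

      B≤4t : B ≤ 4 * t
      B≤4t = subst (λ l → B ≤ 4 * l) (Co.length-factor b t) (total≤*-length deficit deficit≤4 v)

      B≤N : B ≤ N
      B≤N = ≤-trans (≤-trans (m≤m+n B 3) B+3≤)
        (≤-trans (m≤n+m _ (2 * total isE Sn.W)) (≤-reflexive feasible))

      -- 2 t is less than the number 2 α - 1 of letters D in a full period.
      short : d ≤ 2 * t → m ≤ β
      short d≤2t with ≤-total m β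
      ... | inj₁ m≤β = m≤β
      ... | inj₂ β≤m = contradiction (begin
        2 * t + 2 * 1             ≡⟨ *-distribˡ-+ 2 t 1 ⟨
        2 * (t + 1)               ≡⟨ cong (2 *_) (+-comm t 1) ⟩
        2 * suc t                 ≤⟨ *-monoʳ-≤ 2 t<α ⟩
        2 * α                     ≡⟨ balance ⟨
        total isD Sn.W + 1        ≤⟨ +-monoˡ-≤ 1 (≤-trans (Sn.total-factor-≥ isD a β≤m) d≤2t) ⟩
        2 * t + 1                 ∎)
        (<⇒≱ (+-monoʳ-< (2 * t) (n<1+n 1)))
        where open ≤-Reasoning

      -- The snake stretch stays within one period, and the co-snake stretch misses a letter of its
      -- period; the 3 is the least deficit of that letter.
      small : d ≤ 2 * t → 2 * e + B + 3 ≤ N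
      small d≤2t = begin
        2 * e + B + 3                               ≡⟨ +-assoc (2 * e) B 3 ⟩
        2 * e + (B + 3)                             ≤⟨ +-mono-≤ (*-monoʳ-≤ 2 (Sn.total-factor-≤ isE a (short d≤2t))) B+3≤ ⟩
        2 * total isE Sn.W + total deficit Co.W     ≡⟨ feasible ⟩
        N                                           ∎
        where open ≤-Reasoning

      open Distances {N} {d} {e} {t} {B} (m≤n+m 1 n) 3t≤B B≤4t B≤N small
        using (behind; ahead; beside; coincident)

      p q : ℕ
      p = total lenS u
      q = total lenC v

      p≡ : p ≡ N * d + 2 * e
      p≡ = total-lenS u

      q≡ : q + B ≡ N * (2 * t)
      q≡ = trans (total-lenC v) (cong (λ l → N * (2 * l)) (Co.length-factor b t))

      p+B≡ : p + B ≡ N * d + (2 * e + B)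
      p+B≡ = trans (cong (_+ B) p≡) (+-assoc (N * d) (2 * e) B)

    admissible-behind : ∀ {δ} → q + δ ≡ p → Admissible N δ
    admissible-behind {δ} eq = behind (begin
      N * (2 * t) + δ       ≡⟨ cong (_+ δ) q≡ ⟨
      q + B + δ             ≡⟨ swap q B δ ⟩
      q + δ + B             ≡⟨ cong (_+ B) eq ⟩
      p + B                 ≡⟨ p+B≡ ⟩
      N * d + (2 * e + B)   ∎)
      where
      open ≡-Reasoning
      swap : ∀ x y z → x + y + z ≡ x + z + y
      swap = solve-∀

    admissible-ahead : ∀ {δ} → p + δ ≡ q → Admissible N δ
    admissible-ahead {δ} eq = ahead (begin
      N * d + (2 * e + B) + δ ≡⟨ cong (_+ δ) p+B≡ ⟨
      p + B + δ               ≡⟨ swap p B δ ⟩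
      p + δ + B               ≡⟨ cong (_+ B) eq ⟩
      q + B                   ≡⟨ q≡ ⟩
      N * (2 * t)             ∎)
      where
      open ≡-Reasoning
      swap : ∀ x y z → x + y + z ≡ x + z + y
      swap = solve-∀

    admissible-beside : ∀ {δ} → δ ≡ p + q → Admissible N δ
    admissible-beside {δ} eq = beside (begin
      δ + B                             ≡⟨ cong (_+ B) eq ⟩
      p + q + B                         ≡⟨ +-assoc p q B ⟩
      p + (q + B)                       ≡⟨ cong₂ _+_ p≡ q≡ ⟩
      N * d + 2 * e + N * (2 * t)       ≡⟨ distr N d (2 * e) (2 * t) ⟩
      N * (d + 2 * t) + 2 * e           ∎)
      where
      open ≡-Reasoning
      distr : ∀ N d e t → N * d + e + N * t ≡ N * (d + t) + e
      distr = solve-∀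

    coincident-stretches : q ≡ p → t ≡ 0
    coincident-stretches eq = coincident (trans (sym q≡) (trans (cong (_+ B) eq) p+B≡))

  -- If A ≤ A′ the two stretches add up; otherwise δ is what the co-snake stretch has in excess of
  -- the snake stretch.
  admissible-forward : ∀ A A′ b {t δ} → t < α →
    P A + δ ≡ P A′ + total lenC (Co.factor b t) → Admissible N δ
  admissible-forward A A′ b {t} {δ} t<α eq with ≤-total A A′
  ... | inj₁ A≤A′ with m≤n⇒∃[o]m+o≡n A≤A′
  ...   | m , refl = Stretch.admissible-beside A m b t<α
          (+-cancelˡ-≡ (P A) δ _ (trans eq
            (trans (cong (_+ total lenC (Co.factor b t)) (Sn.prefix-+ lenS A m)) (+-assoc (P A) _ _))))
  admissible-forward A A′ b {t} {δ} t<α eq | inj₂ A′≤A with m≤n⇒∃[o]m+o≡n A′≤A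
  ...   | m , refl = Stretch.admissible-ahead A′ m b t<α
          (+-cancelˡ-≡ (P A′) _ _ (trans (sym (+-assoc (P A′) _ δ))
            (trans (cong (_+ δ) (sym (Sn.prefix-+ lenS A′ m))) eq)))

  admissible-backward : ∀ A A′ b {t δ} → t < α →
    P A + (total lenC (Co.factor b t) + δ) ≡ P A′ → Admissible N δ
  admissible-backward A A′ b {t} {δ} t<α eq with ≤-total A A′
  ... | inj₁ A≤A′ with m≤n⇒∃[o]m+o≡n A≤A′
  ...   | m , refl = Stretch.admissible-behind A m b t<α
          (+-cancelˡ-≡ (P A) _ _ (trans eq (Sn.prefix-+ lenS A m)))
  admissible-backward A A′ b {t} {δ} t<α eq | inj₂ A′≤A with m≤n⇒∃[o]m+o≡n A′≤A
  ...   | m , refl = null (m+n≡0⇒n≡0 (total lenC (Co.factor b t))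
          (n≤0⇒n≡0 (+-cancelˡ-≤ (P (A′ + m)) _ 0 (begin
            P (A′ + m) + (total lenC (Co.factor b t) + δ)   ≡⟨ eq ⟩
            P A′                                            ≤⟨ m≤m+n (P A′) _ ⟩
            P A′ + total lenS (Sn.factor A′ m)              ≡⟨ Sn.prefix-+ lenS A′ m ⟨
            P (A′ + m)                                      ≡⟨ +-identityʳ _ ⟨
            P (A′ + m) + 0                                  ∎))))
          where open ≤-Reasoning

  -- Whole periods are split off so that fewer than α co-letters remain, as `Stretch` requires; the
  -- multiple of M can then be moved over to `P`.
  Q-split : ∀ b o → Q (b + o) ≡ Q b + total lenC (Co.factor b (o % α)) + o / α * M
  Q-split b o = begin
    Q (b + o)                                  ≡⟨ cong (λ x → Q (b + x)) (m≡m%n+[m/n]*n o α) ⟩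
    Q (b + (o % α + o / α * α))                ≡⟨ cong Q (+-assoc b (o % α) _) ⟨
    Q (b + o % α + o / α * α)                  ≡⟨ Q-periods (b + o % α) (o / α) ⟩
    Q (b + o % α) + o / α * M                  ≡⟨ cong (_+ o / α * M) (Co.prefix-+ lenC b (o % α)) ⟩
    Q b + total lenC (Co.factor b (o % α)) + o / α * M  ∎
    where open ≡-Reasoning

  admissible : ∀ A b A′ b′ {δ} → P A + Q b + δ ≡ P A′ + Q b′ → Admissible N δ
  admissible A b A′ b′ {δ} eq with ≤-total b b′
  ... | inj₁ b≤b′ with m≤n⇒∃[o]m+o≡n b≤b′
  ...   | o , refl = admissible-forward A (A′ + o / α * β) b (m%n<n o α)
          (+-cancelʳ-≡ (Q b) _ _ (begin
            P A + δ + Q b                         ≡⟨ swap (P A) δ (Q b) ⟩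
            P A + Q b + δ                         ≡⟨ eq ⟩
            P A′ + Q (b + o)                      ≡⟨ cong (λ x → P A′ + x) (Q-split b o) ⟩
            P A′ + (Q b + q + o / α * M)          ≡⟨ rearrange (P A′) (Q b) q (o / α * M) ⟩
            P A′ + o / α * M + q + Q b            ≡⟨ cong (λ x → x + q + Q b) (P-periods A′ (o / α)) ⟨
            P (A′ + o / α * β) + q + Q b          ∎))
          where
          open ≡-Reasoning
          q = total lenC (Co.factor b (o % α))
          swap : ∀ x y z → x + y + z ≡ x + z + y
          swap = solve-∀
          rearrange : ∀ x y z w → x + (y + z + w) ≡ x + w + z + y
          rearrange = solve-∀
  admissible A b A′ b′ {δ} eq | inj₂ b′≤b with m≤n⇒∃[o]m+o≡n b′≤b
  ...   | o , refl = admissible-backward (A + o / α * β) A′ b′ (m%n<n o α)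
          (+-cancelʳ-≡ (Q b′) _ _ (begin
            P (A + o / α * β) + (q + δ) + Q b′    ≡⟨ cong (λ x → x + (q + δ) + Q b′) (P-periods A (o / α)) ⟩
            P A + o / α * M + (q + δ) + Q b′      ≡⟨ rearrange (P A) (o / α * M) q δ (Q b′) ⟩
            P A + (Q b′ + q + o / α * M) + δ      ≡⟨ cong (λ x → P A + x + δ) (Q-split b′ o) ⟨
            P A + Q (b′ + o) + δ                  ≡⟨ eq ⟩
            P A′ + Q b′                           ∎))
          where
          open ≡-Reasoning
          q = total lenC (Co.factor b′ (o % α))
          rearrange : ∀ x w q δ y → x + w + (q + δ) + y ≡ x + (y + q + w) + δ
          rearrange = solve-∀

  -- The grid of live positions

  -- Negative positions are reached through the common period M of both words.
  position : ℕ → ℕ → ℕ → ℤ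
  position a b y = + (P a + Q b) ℤ.- + (y * M)

  OnGrid : ℤ → Set
  OnGrid k = ∃[ a ] ∃[ b ] ∃[ y ] k ≡ position a b y

  onGrid : ∀ a b y → OnGrid (position a b y)
  onGrid a b y = a , b , y , refl

  position-sucˢ : ∀ a b y → position (suc a) b y ≡ position a b y ℤ.+ + lenS (Sn.letter a)
  position-sucˢ a b y = trans
    (cong (λ x → + (x + Q b) ℤ.- + (y * M)) (Sn.prefix-suc lenS a))
    (eq (+ P a) (+ lenS (Sn.letter a)) (+ Q b) (+ (y * M)))
    where
    eq : ∀ p l q m → p ℤ.+ l ℤ.+ q ℤ.- m ≡ p ℤ.+ q ℤ.- m ℤ.+ l
    eq = ℤSolver.solve-∀

  position-sucᶜ : ∀ a b y → position a (suc b) y ≡ position a b y ℤ.+ + lenC (Co.letter b)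
  position-sucᶜ a b y = trans
    (cong (λ x → + (P a + x) ℤ.- + (y * M)) (Co.prefix-suc lenC b))
    (eq (+ P a) (+ lenC (Co.letter b)) (+ Q b) (+ (y * M)))
    where
    eq : ∀ p l q m → p ℤ.+ (q ℤ.+ l) ℤ.- m ≡ p ℤ.+ q ℤ.- m ℤ.+ l
    eq = ℤSolver.solve-∀

  position-wrapˢ : ∀ a b y → position (a + β) b (suc y) ≡ position a b y
  position-wrapˢ a b y = trans
    (cong (λ x → + (x + Q b) ℤ.- + (suc y * M)) (Sn.prefix-period lenS a))
    (eq (+ P a) (+ M) (+ Q b) (+ (y * M)))
    where
    eq : ∀ p l q m → p ℤ.+ l ℤ.+ q ℤ.- (l ℤ.+ m) ≡ p ℤ.+ q ℤ.- m
    eq = ℤSolver.solve-∀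

  position-wrapᶜ : ∀ a b y → position a (b + α) (suc y) ≡ position a b y
  position-wrapᶜ a b y = trans
    (cong (λ x → + (P a + x) ℤ.- + (suc y * M))
      (trans (Co.prefix-period lenC b) (cong (λ x → Q b + x) total-lenC-W)))
    (eq (+ P a) (+ M) (+ Q b) (+ (y * M)))
    where
    eq : ∀ p l q m → p ℤ.+ (q ℤ.+ l) ℤ.- (l ℤ.+ m) ≡ p ℤ.+ q ℤ.- m
    eq = ℤSolver.solve-∀

  position-exchange : ∀ a b q y → position a (b + q * α) y ≡ position (a + q * β) b y
  position-exchange a b q y = cong (λ x → + x ℤ.- + (y * M)) (begin
    P a + Q (b + q * α)       ≡⟨ cong (λ x → P a + x) (Q-periods b q) ⟩
    P a + (Q b + q * M)       ≡⟨ swap (P a) (Q b) (q * M) ⟩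
    P a + q * M + Q b         ≡⟨ cong (_+ Q b) (P-periods a q) ⟨
    P (a + q * β) + Q b       ∎)
    where
    open ≡-Reasoning
    swap : ∀ x y z → x + (y + z) ≡ x + z + y
    swap = solve-∀

  onGrid-shift : ∀ {k} y → OnGrid k → OnGrid (k ℤ.- + (y * M))
  onGrid-shift y (a , b , y′ , refl) = a , b , y′ + y , trans
    (eq (+ (P a + Q b)) (+ (y′ * M)) (+ (y * M)))
    (cong (λ x → + (P a + Q b) ℤ.- + x) (sym (*-distribʳ-+ M y′ y)))
    where
    eq : ∀ p x y → p ℤ.- x ℤ.- y ≡ p ℤ.- (x ℤ.+ y)
    eq = ℤSolver.solve-∀

  onGrid-admissible : ∀ {k δ} → OnGrid k → OnGrid (k ℤ.+ + δ) → Admissible N δ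
  onGrid-admissible {δ = δ} (a , b , y , refl) (a′ , b′ , y′ , eq) =
    -- Each side takes over the periods subtracted on the other, which clears the negative terms
    -- from `eq`.
    admissible (a + y′ * β) b (a′ + y * β) b′ (begin
      P (a + y′ * β) + Q b + δ      ≡⟨ cong (λ x → x + Q b + δ) (P-periods a y′) ⟩
      P a + y′ * M + Q b + δ        ≡⟨ ℤ.+-injective cleared ⟩
      P a′ + y * M + Q b′           ≡⟨ cong (_+ Q b′) (P-periods a′ y) ⟨
      P (a′ + y * β) + Q b′         ∎)
    where
    open ≡-Reasoning
    left : ∀ p z q d w → p ℤ.+ w ℤ.+ q ℤ.+ d ≡ (p ℤ.+ q ℤ.- z ℤ.+ d) ℤ.+ (z ℤ.+ w)
    left = ℤSolver.solve-∀
    right : ∀ p z q w → (p ℤ.+ q ℤ.- w) ℤ.+ (z ℤ.+ w) ≡ p ℤ.+ z ℤ.+ q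
    right = ℤSolver.solve-∀
    cleared : + (P a + y′ * M + Q b + δ) ≡ + (P a′ + y * M + Q b′)
    cleared = trans (left (+ P a) (+ (y * M)) (+ Q b) (+ δ) (+ (y′ * M)))
      (trans (cong (ℤ._+ (+ (y * M) ℤ.+ + (y′ * M))) eq) (right (+ P a′) (+ (y * M)) (+ Q b′) (+ (y′ * M))))

  inadmissible-1 : ¬ Admissible N 1
  inadmissible-1 (middle 2≤1 _) = contradiction 2≤1 λ { (s≤s ()) }
  inadmissible-1 (large N≤1)    = contradiction (≤-trans (+-monoˡ-≤ 1 1≤n) N≤1) λ { (s≤s ()) }

  inadmissible-n : ¬ Admissible N n
  inadmissible-n (null n≡0)      = contradiction (subst (1 ≤_) n≡0 1≤n) λ ()
  inadmissible-n (middle _ n+3≤N) = contradiction (+-cancelˡ-≤ n 3 1 n+3≤N) λ { (s≤s ()) }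
  inadmissible-n (large N≤n)     = contradiction (m<m+n n z<s) (≤⇒≯ N≤n)

  inadmissible-n∸1 : ¬ Admissible N (n ∸ 1)
  inadmissible-n∸1 (null n∸1≡0)  = contradiction
    (subst (2 ≤_) (trans (sym n-1) (cong (_+ 1) n∸1≡0)) 2≤n) λ { (s≤s ()) }
  inadmissible-n∸1 (middle _ le) = contradiction
    (≤-trans (≤-reflexive (trans (cong (_+ 2) (sym n-1)) (+-assoc (n ∸ 1) 1 2))) le)
    (<⇒≱ (+-monoʳ-< n (n<1+n 1)))
  inadmissible-n∸1 (large N≤)    = contradiction (≤-trans N≤ (m∸n≤m n 1)) (<⇒≱ (m<m+n n z<s))

  -- Four translates of the grid cover the integers

  data Offset : ℕ → Set where
    0#   : Offset 0
    1#   : Offset 1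
    n∸1# : Offset (n ∸ 1)
    n#   : Offset n

  Covered : ℤ → Set
  Covered k = ∃[ v ] ∃[ o ] (OnGrid v × Offset o × k ≡ v ℤ.+ + o)

  private
    coSuccessor-offset : ∀ v w x {o} → w ℤ.+ + x ≡ v ℤ.+ + N → x + 2 ≡ N + o → v ℤ.+ + 2 ≡ w ℤ.+ + o
    coSuccessor-offset v w x {o} eq x+2≡N+o = begin
      v ℤ.+ + 2                          ≡⟨ left v (+ N) (+ 2) ⟩
      v ℤ.+ + N ℤ.+ (+ 2 ℤ.- + N)        ≡⟨ cong (ℤ._+ (+ 2 ℤ.- + N)) eq ⟨
      w ℤ.+ + x ℤ.+ (+ 2 ℤ.- + N)        ≡⟨ mid w (+ x) (+ 2) (+ N) ⟩
      w ℤ.+ (+ (x + 2) ℤ.- + N)          ≡⟨ cong (λ z → w ℤ.+ (+ z ℤ.- + N)) x+2≡N+o ⟩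
      w ℤ.+ (+ (N + o) ℤ.- + N)          ≡⟨ right w (+ N) (+ o) ⟩
      w ℤ.+ + o                          ∎
      where
      open ≡-Reasoning
      left : ∀ v n t → v ℤ.+ t ≡ v ℤ.+ n ℤ.+ (t ℤ.- n)
      left = ℤSolver.solve-∀
      mid : ∀ w x t n → w ℤ.+ x ℤ.+ (t ℤ.- n) ≡ w ℤ.+ ((x ℤ.+ t) ℤ.- n)
      mid = ℤSolver.solve-∀
      right : ∀ w n o → w ℤ.+ ((n ℤ.+ o) ℤ.- n) ≡ w ℤ.+ o
      right = ℤSolver.solve-∀

    n-then-1 : ∀ k → k ℤ.+ + n ≡ k ℤ.+ + (n ∸ 1) ℤ.+ + 1
    n-then-1 k = trans (cong (λ m → k ℤ.+ + m) (sym n-1)) (sym (ℤ.+-assoc k (+ (n ∸ 1)) (+ 1)))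

    1-then-n∸1 : ∀ k → k ℤ.+ + 1 ℤ.+ + (n ∸ 1) ≡ k ℤ.+ + n
    1-then-n∸1 k = trans (ℤ.+-assoc k (+ 1) (+ (n ∸ 1)))
      (cong (λ m → k ℤ.+ + m) (trans (+-comm 1 (n ∸ 1)) n-1))

    2-then-n∸1 : ∀ k → k ℤ.+ + 2 ℤ.+ + (n ∸ 1) ≡ k ℤ.+ + N
    2-then-n∸1 k = trans (ℤ.+-assoc k (+ 2) (+ (n ∸ 1)))
      (cong (λ m → k ℤ.+ + m) (trans (cong suc (trans (+-comm 1 (n ∸ 1)) n-1)) (+-comm 1 n)))

  -- Offsets 0 and n - 1 pass to 1 and n. From v + n the next position is the snake successor of v
  -- after `D`, and that successor plus n - 1 after `E`. From v + 1 it is the successor after `E`;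
  -- after `D` it has offset n or n - 1 from the co-predecessor w of the successor v + N.
  covered-suc : ∀ {k} → Covered k → Covered (k ℤ.+ + 1)
  covered-suc (v , _ , v∈ , 0# , refl) = v , 1 , v∈ , 1# , ℤ.+-assoc v (+ 0) (+ 1)
  covered-suc (v , _ , (a , b , y , refl) , 1# , refl) with Sn.letter a | position-sucˢ a b y
  ... | E | eq = position (suc a) b y , 0 , onGrid (suc a) b y , 0# ,
        trans (ℤ.+-assoc v (+ 1) (+ 1)) (trans (sym eq) (sym (ℤ.+-identityʳ _)))
  -- One co-step back, written as α - 1 steps forward and one period less.
  ... | D | eq with Co.letter (b + length Wc′) | position-sucᶜ (suc a) (b + length Wc′) (suc y)
  ...   | x | eqᶜ = split x (trans (sym eqᶜ) (trans (trans
            (cong (λ c → position (suc a) c (suc y)) (sym (+-suc b (length Wc′))))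
            (position-wrapᶜ (suc a) b y)) eq))
    where
    w = position (suc a) (b + length Wc′) (suc y)
    w∈ : OnGrid w
    w∈ = onGrid (suc a) (b + length Wc′) (suc y)
    split : ∀ x → w ℤ.+ + lenC x ≡ v ℤ.+ + N → Covered (v ℤ.+ + 1 ℤ.+ + 1)
    split S e = w , n , w∈ , n# , trans (ℤ.+-assoc v (+ 1) (+ 1))
      (coSuccessor-offset v w (lenC S) e (trans (sym (+-assoc _ 1 1)) (trans (cong (_+ 1) 2n-1) (arith n))))
      where
      arith : ∀ n → 2 * n + 1 ≡ n + 1 + n
      arith = solve-∀
    split L e = w , n ∸ 1 , w∈ , n∸1# , trans (ℤ.+-assoc v (+ 1) (+ 1))
      (coSuccessor-offset v w (lenC L) e (trans 2n-2 (trans (cong (2 *_) (sym n-1))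
        (trans (arith (n ∸ 1)) (cong (λ m → m + 1 + (n ∸ 1)) n-1)))))
      where
      arith : ∀ m → 2 * (m + 1) ≡ m + 1 + 1 + m
      arith = solve-∀
  covered-suc (v , _ , v∈ , n∸1# , refl) = v , n , v∈ , n# , sym (n-then-1 v)
  covered-suc (v , _ , (a , b , y , refl) , n# , refl) with Sn.letter a | position-sucˢ a b y
  ... | D | eq = position (suc a) b y , 0 , onGrid (suc a) b y , 0# ,
        trans (ℤ.+-assoc v (+ n) (+ 1)) (trans (sym eq) (sym (ℤ.+-identityʳ _)))
  ... | E | eq = position (suc a) b y , n ∸ 1 , onGrid (suc a) b y , n∸1# ,
        trans (ℤ.+-assoc v (+ n) (+ 1)) (trans (sym (2-then-n∸1 v)) (cong (ℤ._+ + (n ∸ 1)) (sym eq)))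

  covered-ℕ : ∀ m → Covered (+ m)
  covered-ℕ zero    = + 0 , 0 , onGrid 0 0 0 , 0# , refl
  covered-ℕ (suc m) = subst (Covered ∘ +_) (+-comm m 1) (covered-suc (covered-ℕ m))

  covered : ∀ k → Covered k
  covered (+ m)    = covered-ℕ m
  -- Since M ≥ 1, going up by (j + 1) M gives a natural number `m`; its cover is translated back by
  -- as many periods.
  covered -[1+ j ] with m≤n⇒∃[o]m+o≡n (m≤m*n (suc j) M {{>-nonZero M>0}})
  ... | m , j+m≡ with covered-ℕ m
  ...   | v , o , v∈ , off , eq = v ℤ.- + (suc j * M) , o , onGrid-shift (suc j) v∈ , off , (begin
    -[1+ j ]                              ≡⟨ cancel (+ suc j) (+ m) ⟩
    + m ℤ.- + (suc j + m)                 ≡⟨ cong (λ x → + m ℤ.- + x) j+m≡ ⟩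
    + m ℤ.- + (suc j * M)                 ≡⟨ cong (ℤ._- + (suc j * M)) eq ⟩
    v ℤ.+ + o ℤ.- + (suc j * M)           ≡⟨ swap v (+ o) (+ (suc j * M)) ⟩
    v ℤ.- + (suc j * M) ℤ.+ + o           ∎)
    where
    open ≡-Reasoning
    cancel : ∀ j m → ℤ.- j ≡ m ℤ.- (j ℤ.+ m)
    cancel = ℤSolver.solve-∀
    swap : ∀ v o z → v ℤ.+ o ℤ.- z ≡ v ℤ.- z ℤ.+ o
    swap = ℤSolver.solve-∀

  -- The tape and its local rules

  separate : ∀ {k k′ δ} → ¬ Admissible N δ → k ℤ.+ + δ ≡ k′ → OnGrid k → ¬ OnGrid k′
  separate ¬adm refl k∈ k′∈ = ¬adm (onGrid-admissible k∈ k′∈)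

  -- The cover decides membership: a nonzero offset from a grid point is an inadmissible distance,
  -- so `k` is then off the grid.
  onGrid? : ∀ k → Dec (OnGrid k)
  onGrid? k with covered k
  ... | v , _ , v∈ , 0#   , eq = yes (subst OnGrid (trans (sym (ℤ.+-identityʳ v)) (sym eq)) v∈)
  ... | v , _ , v∈ , 1#   , eq = no (separate inadmissible-1 (sym eq) v∈)
  ... | v , _ , v∈ , n∸1# , eq = no (separate inadmissible-n∸1 (sym eq) v∈)
  ... | v , _ , v∈ , n#   , eq = no (separate inadmissible-n (sym eq) v∈)

  tape : ℤ → Bool
  tape k = does (onGrid? k)

  tape-onGrid : ∀ k → tape k ≡ true → OnGrid k
  tape-onGrid k eq with onGrid? k
  ... | yes k∈ = k∈

  onGrid-tape : ∀ k → OnGrid k → tape k ≡ true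
  onGrid-tape k = dec-true (onGrid? k)

  offGrid-tape : ∀ k → ¬ OnGrid k → tape k ≡ false
  offGrid-tape k = dec-false (onGrid? k)

  -- The cover of k + n supplies a live position among k + n, k + n - 1, k + 1 and k, and the
  -- hypotheses rule out the last three.
  tape-maximal : ∀ k → tape k ≡ false → tape (k ℤ.+ + 1) ≡ false → tape (k ℤ.+ + (n ∸ 1)) ≡ false →
    tape (k ℤ.+ + n) ≡ true
  tape-maximal k t₀ t₁ t₂ = by (covered (k ℤ.+ + n))
    where
    blocked : ∀ k′ {v} o {b} → OnGrid v → tape k′ ≡ false → k′ ℤ.+ + o ≡ v ℤ.+ + o → b ≡ true
    blocked k′ {v} o v∈ t eq = contradiction
      (trans (sym (onGrid-tape k′ (subst OnGrid (∙-cancelʳ (+ o) v k′ (sym eq)) v∈))) t) λ ()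
    by : Covered (k ℤ.+ + n) → tape (k ℤ.+ + n) ≡ true
    by (v , _ , v∈ , 0#   , eq) = onGrid-tape _ (subst OnGrid (trans (sym (ℤ.+-identityʳ v)) (sym eq)) v∈)
    by (v , _ , v∈ , 1#   , eq) = blocked (k ℤ.+ + (n ∸ 1)) 1 v∈ t₂ (trans (sym (n-then-1 k)) eq)
    by (v , _ , v∈ , n∸1# , eq) = blocked (k ℤ.+ + 1) (n ∸ 1) v∈ t₁ (trans (1-then-n∸1 k) eq)
    by (v , _ , v∈ , n#   , eq) = blocked k n v∈ t₀ eq

  tape-sparse : ∀ k → tape k ≡ true → tape (k ℤ.+ + 1) ≡ false
  tape-sparse k t = offGrid-tape _ (separate inadmissible-1 refl (tape-onGrid k t))

  tape-sparseₙ₋₁ : ∀ k → tape (k ℤ.+ + n) ≡ true → tape (k ℤ.+ + 1) ≡ false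
  tape-sparseₙ₋₁ k t = offGrid-tape (k ℤ.+ + 1) λ k+1∈ →
    separate inadmissible-n∸1 (1-then-n∸1 k) k+1∈ (tape-onGrid (k ℤ.+ + n) t)

  tape-sparseₙ : ∀ k → tape k ≡ true → tape (k ℤ.+ + n) ≡ false
  tape-sparseₙ k t = offGrid-tape _ (separate inadmissible-n refl (tape-onGrid k t))

  -- Distinctness of snakes and co-snakes

  stretch-length : ∀ a m → m ≤ total lenS (Sn.factor a m)
  stretch-length a m = begin
    m                                  ≡⟨ Sn.length-factor a m ⟨
    length (Sn.factor a m)             ≡⟨ *-identityˡ _ ⟨
    1 * length (Sn.factor a m)         ≤⟨ *-length≤total lenS 1≤lenS (Sn.factor a m) ⟩
    total lenS (Sn.factor a m)         ∎
    where open ≤-Reasoning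

  +-none : ∀ i {o} → o ≡ 0 → i + o ≡ i
  +-none i refl = +-identityʳ i

  -- If snakes `i` and `i′` met, the co-snake stretch between their indices, of fewer than α
  -- letters, would be as long as a snake stretch; by `coincident-stretches` it is empty.
  snakes-distinct : ∀ a {i i′} → i < α → i′ < α → P a + Q i ≡ Q i′ → i ≡ i′
  snakes-distinct a {i} {i′} i<α i′<α eq with ≤-total i′ i
  ... | inj₁ i′≤i with m≤n⇒∃[o]m+o≡n i′≤i
  ...   | o , refl = +-none i′ (Stretch.coincident-stretches 0 0 i′ (≤-<-trans (m≤n+m o i′) i<α)
          (m+n≡0⇒n≡0 (P a) (+-cancelˡ-≡ (Q i′) _ 0 (begin
            Q i′ + (P a + q)     ≡⟨ swap (Q i′) (P a) q ⟩
            P a + (Q i′ + q)     ≡⟨ cong (λ z → P a + z) (Co.prefix-+ lenC i′ o) ⟨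
            P a + Q (i′ + o)     ≡⟨ eq ⟩
            Q i′                 ≡⟨ +-identityʳ (Q i′) ⟨
            Q i′ + 0             ∎))))
    where
    open ≡-Reasoning
    q = total lenC (Co.factor i′ o)
    swap : ∀ x y z → x + (y + z) ≡ y + (x + z)
    swap = solve-∀
  snakes-distinct a {i} {i′} i<α i′<α eq | inj₂ i≤i′ with m≤n⇒∃[o]m+o≡n i≤i′
  ...   | o , refl = sym (+-none i (Stretch.coincident-stretches 0 a i (≤-<-trans (m≤n+m o i) i′<α)
          (+-cancelˡ-≡ (Q i) _ _ (begin
            Q i + total lenC (Co.factor i o)  ≡⟨ Co.prefix-+ lenC i o ⟨
            Q (i + o)                         ≡⟨ eq ⟨
            P a + Q i                         ≡⟨ +-comm (P a) (Q i) ⟩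
            Q i + P a                         ∎))))
    where open ≡-Reasoning

  cosnakes-distinct : ∀ b {i i′} → i < β → i′ < β → P i + Q b ≡ P i′ → i ≡ i′
  cosnakes-distinct b {i} {i′} i<β i′<β eq with ≤-total i′ i
  ... | inj₁ i′≤i with m≤n⇒∃[o]m+o≡n i′≤i
  ...   | o , refl = +-none i′ (n≤0⇒n≡0 (≤-trans (stretch-length i′ o) (≤-reflexive
          (m+n≡0⇒m≡0 p (+-cancelˡ-≡ (P i′) _ 0 (begin
            P i′ + (p + Q b)     ≡⟨ +-assoc (P i′) p (Q b) ⟨
            P i′ + p + Q b       ≡⟨ cong (_+ Q b) (Sn.prefix-+ lenS i′ o) ⟨
            P (i′ + o) + Q b     ≡⟨ eq ⟩
            P i′                 ≡⟨ +-identityʳ (P i′) ⟨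
            P i′ + 0             ∎))))))
    where
    open ≡-Reasoning
    p = total lenS (Sn.factor i′ o)
  cosnakes-distinct b {i} {i′} i<β i′<β eq | inj₂ i≤i′ with m≤n⇒∃[o]m+o≡n i≤i′
  ...   | o , refl = sym (+-none i (empty (b / α) (trans (sym (Q-split 0 b)) Qb≡p)))
    where
    p = total lenS (Sn.factor i o)
    Qb≡p : Q b ≡ p
    Qb≡p = +-cancelˡ-≡ (P i) (Q b) p (trans eq (Sn.prefix-+ lenS i o))
    p<M : p + 1 ≤ M
    p<M = Sn.total-factor-< lenS 1≤lenS i (≤-<-trans (m≤n+m o i) i′<β)
    -- `c` counts the full co-periods in `Q b`. As p < M there are none, and the remaining co-snake
    -- stretch, equal in length to a snake stretch, is empty; so p = 0 and o = 0.
    empty : ∀ c → total lenC (Co.factor 0 (b % α)) + c * M ≡ p → o ≡ 0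
    empty zero    e = n≤0⇒n≡0 (≤-trans (stretch-length i o) (≤-reflexive (trans (sym e′)
        (cong (λ t → total lenC (Co.factor 0 t)) (Stretch.coincident-stretches i o 0 (m%n<n b α) e′)))))
      where
      e′ : total lenC (Co.factor 0 (b % α)) ≡ p
      e′ = trans (sym (+-identityʳ _)) e
    empty (suc c) e = contradiction
      (≤-trans (≤-trans (m≤m+n M (c * M)) (m≤n+m _ (total lenC (Co.factor 0 (b % α))))) (≤-reflexive e))
      (<⇒≱ (≤-trans (≤-reflexive (+-comm 1 p)) p<M))

  -- Snakes, co-snakes and their words on the tape

  -- `T` is only assumed to agree pointwise with `tape`, since the tape of the scroll recomposes
  -- each position from quotient and remainder by n.
  module Steps (T : ℤ → Bool) (T≗tape : ∀ k → T k ≡ tape k) where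

    private
      live : ∀ {k k′} → OnGrid k → k ≡ k′ → T k′ ≡ true
      live {k} k∈ refl = trans (T≗tape k) (onGrid-tape k k∈)

      dead : ∀ {k} → ¬ OnGrid k → T k ≡ false
      dead {k} k∉ = trans (T≗tape k) (offGrid-tape k k∉)

      live-onGrid : ∀ {k} → Live T k → OnGrid k
      live-onGrid {k} l = tape-onGrid k (trans (sym (T≗tape k)) l)

      clash : ∀ {b} {A : Set} → b ≡ true → b ≡ false → A
      clash refl ()

      lenC-S : ∀ k → k ℤ.+ + lenC L ℤ.+ + 1 ≡ k ℤ.+ + lenC S
      lenC-S k = trans (ℤ.+-assoc k (+ lenC L) (+ 1)) (cong (λ m → k ℤ.+ + m)
        (+-cancelʳ-≡ 1 _ _ (trans (+-assoc (lenC L) 1 1) (trans 2n-2 (sym 2n-1)))))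

    -- The two candidates k + 2 and k + n + 1 differ by n - 1, so the one not chosen by the letter
    -- is dead.
    sStep : ∀ a b y → SStep n T (position a b y) (Sn.letter a) (position (suc a) b y)
    sStep a b y with Sn.letter a | position-sucˢ a b y
    ... | E | eq = eq , live s∈ eq ,
          dead (separate inadmissible-n∸1 (trans (cong (ℤ._+ + (n ∸ 1)) eq) (2-then-n∸1 (position a b y))) s∈)
      where
      s∈ : OnGrid (position (suc a) b y)
      s∈ = onGrid (suc a) b y
    ... | D | eq = eq ,
          dead (λ k∈ → separate inadmissible-n∸1 (trans (2-then-n∸1 (position a b y)) (sym eq)) k∈ s∈) , live s∈ eq
      where
      s∈ : OnGrid (position (suc a) b y)
      s∈ = onGrid (suc a) b y

    -- The two candidates differ by 1, so a live one makes the other dead.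
    cStep : ∀ a b y → CStep n T (position a b y) (Co.letter b) (position a (suc b) y)
    cStep a b y with Co.letter b | position-sucᶜ a b y
    ... | S | eq = eq , live c∈ eq ,
          dead (λ k∈ → separate inadmissible-1 (trans (lenC-S (position a b y)) (sym eq)) k∈ c∈)
      where
      c∈ : OnGrid (position a (suc b) y)
      c∈ = onGrid a (suc b) y
    ... | L | eq = eq ,
          dead (separate inadmissible-1 (trans (cong (ℤ._+ + 1) eq) (lenC-S (position a b y))) c∈) , live c∈ eq
      where
      c∈ : OnGrid (position a (suc b) y)
      c∈ = onGrid a (suc b) y

    sStep-deterministic : ∀ {k t k′ t′ k″} → SStep n T k t k′ → SStep n T k t′ k″ → k′ ≡ k″
    sStep-deterministic {t = E} {t′ = E} (p , _) (q , _)         = trans p (sym q)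
    sStep-deterministic {t = E} {t′ = D} (_ , p , _) (_ , q , _) = clash p q
    sStep-deterministic {t = D} {t′ = E} (_ , p , _) (_ , q , _) = clash q p
    sStep-deterministic {t = D} {t′ = D} (p , _) (q , _)         = trans p (sym q)

    cStep-deterministic : ∀ {k t k′ t′ k″} → CStep n T k t k′ → CStep n T k t′ k″ → k′ ≡ k″
    cStep-deterministic {t = S} {t′ = S} (p , _) (q , _)         = trans p (sym q)
    cStep-deterministic {t = S} {t′ = L} (_ , p , _) (_ , q , _) = clash p q
    cStep-deterministic {t = L} {t′ = S} (_ , p , _) (_ , q , _) = clash q p
    cStep-deterministic {t = L} {t′ = L} (p , _) (q , _)         = trans p (sym q)

    private
      position₀-injective : ∀ {a b a′ b′} → position a b 0 ≡ position a′ b′ 0 → P a + Q b ≡ P a′ + Q b′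
      position₀-injective eq = ℤ.+-injective (∙-cancelʳ (ℤ.- + 0) _ _ eq)

      reduce : ∀ {r} .{{_ : NonZero r}} → ℕ → Fin r
      reduce {r} m = fromℕ< (m%n<n m r)

      reduce≡ : ∀ {r} .{{_ : NonZero r}} m → m ≡ toℕ (reduce {r} m) + m / r * r
      reduce≡ {r} m = trans (m≡m%n+[m/n]*n m r) (cong (_+ m / r * r) (sym (toℕ-fromℕ< (m%n<n m r))))

      snakes-cover : ∀ k → Live T k → ∃[ i ] ∃[ a ] ∃[ y ] k ≡ position a (toℕ {α} i) y
      snakes-cover k l with live-onGrid l
      ... | a , b , y , eq = reduce b , a + b / α * β , y ,
        trans eq (trans (cong (λ b → position a b y) (reduce≡ {α} b))
          (position-exchange a (toℕ (reduce {α} b)) (b / α) y))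

      cosnakes-cover : ∀ k → Live T k → ∃[ i ] ∃[ b ] ∃[ y ] k ≡ position (toℕ {β} i) b y
      cosnakes-cover k l with live-onGrid l
      ... | a , b , y , eq = reduce a , b + a / β * α , y ,
        trans eq (trans (cong (λ a → position a b y) (reduce≡ {β} a))
          (sym (position-exchange (toℕ (reduce {β} a)) b (a / β) y)))

      snakes-separated : ∀ (i : Fin α) a i′ → position a (toℕ i) 0 ≡ position 0 (toℕ i′) 0 → i ≡ i′
      snakes-separated i a i′ eq = toℕ-injective
        (snakes-distinct a (toℕ<n i) (toℕ<n i′) (position₀-injective {a} {toℕ i} {0} {toℕ i′} eq))

      cosnakes-separated : ∀ (i : Fin β) b i′ → position (toℕ i) b 0 ≡ position (toℕ i′) 0 0 → i ≡ i′
      cosnakes-separated i b i′ eq = toℕ-injective (cosnakes-distinct b (toℕ<n i) (toℕ<n i′)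
        (trans (position₀-injective {toℕ i} {b} {toℕ i′} {0} eq) (+-identityʳ _)))

    module Snakes = Sn.Orbits (SStep n T) T {α} (λ i a y → position a (toℕ i) y)
      (λ i a y → live (onGrid a (toℕ i) y) refl) snakes-cover
      (λ i a y → sStep a (toℕ i) y) sStep-deterministic
      (λ i a y → position-wrapˢ a (toℕ i) y) snakes-separated

    module CoSnakes = Co.Orbits (CStep n T) T {β} (λ i b y → position (toℕ i) b y)
      (λ i b y → live (onGrid (toℕ i) b y) refl) cosnakes-cover
      (λ i b y → cStep (toℕ i) b y) cStep-deterministic
      (λ i b y → position-wrapᶜ (toℕ i) b y) cosnakes-separated

    -- The word is read along snakes, but its length is the number of co-snakes; hence the orbit
    -- count comes from `CoSnakes`.
    hasSlither : HasSlither n T Sn.W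
    hasSlither = β , CoSnakes.numOrbits , Snakes.readings

    hasCoSlither : HasCoSlither n T Co.W
    hasCoSlither = α , Snakes.numOrbits , CoSnakes.readings

    live-zero : Live T (+ 0)
    live-zero = live (onGrid 0 0 0) refl

-- Letter counts and the theorem

total-isD : ∀ w → total isD w ≡ countD w
total-isD []      = refl
total-isD (E ∷ w) = total-isD w
total-isD (D ∷ w) = cong suc (total-isD w)

total-isE : ∀ w → total isE w ≡ countE w
total-isE []      = refl
total-isE (E ∷ w) = cong suc (total-isE w)
total-isE (D ∷ w) = total-isE w

length-count : ∀ w → length w ≡ countS w + countL w
length-count []      = refl
length-count (S ∷ w) = cong suc (length-count w)
length-count (L ∷ w) = trans (cong suc (length-count w)) (sym (+-suc (countS w) (countL w)))

total-deficit : ∀ w → total deficit w ≡ 3 * countS w + 4 * countL w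
total-deficit []      = refl
total-deficit (S ∷ w) = trans (cong (λ m → 3 + m) (total-deficit w)) (eq (countS w) (countL w))
  where
  eq : ∀ s l → 3 + (3 * s + 4 * l) ≡ 3 * (1 + s) + 4 * l
  eq = solve-∀
total-deficit (L ∷ w) = trans (cong (λ m → 4 + m) (total-deficit w)) (eq (countS w) (countL w))
  where
  eq : ∀ s l → 4 + (3 * s + 4 * l) ≡ 3 * s + 4 * (1 + l)
  eq = solve-∀

theorem3p11 : (n : ℕ) .{{_ : NonZero n}} → 2 ≤ n →
    (αS αL βE : ℕ) → 0 < αS + αL →
    (Ws : List SType) → (Wc : List CType) →
    countD Ws ≡ 2 * (αS + αL) ∸ 1 → countE Ws ≡ βE →
    countS Wc ≡ αS → countL Wc ≡ αL →
    2 * βE + 3 * αS + 4 * αL ≡ n + 1 →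
    ∃[ x ] (Independent {n} x ×
    ∃[ X ] (IsScroll x X ×
    ∃[ k ] Live (Tape X) k ×
    HasSlither n (Tape X) Ws ×
    HasCoSlither n (Tape X) Wc))
-- An empty slither has no letter `D`, but 2 (αS + αL) - 1 is positive.
theorem3p11 n 2≤n αS αL βE α>0 [] Wc D≡ E≡ S≡ L≡ sum≡ =
  contradiction D≡ (<⇒≢ (m<n⇒0<n∸m (*-monoʳ-≤ 2 α>0)))
theorem3p11 n 2≤n .0 .0 βE () (s₀ ∷ Ws) [] D≡ E≡ refl refl sum≡
theorem3p11 n 2≤n αS αL βE α>0 (s₀ ∷ Ws) (c₀ ∷ Wc) D≡ refl refl refl sum≡ =
  row (+ 0) , row-independent , row , row-isScroll ,
  + 0 , live-zero , hasSlither , hasCoSlither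
  where
  balance : total isD (s₀ ∷ Ws) + 1 ≡ 2 * length (c₀ ∷ Wc)
  balance = begin
    total isD (s₀ ∷ Ws) + 1            ≡⟨ cong (_+ 1) (trans (total-isD (s₀ ∷ Ws)) D≡) ⟩
    2 * (αS + αL) ∸ 1 + 1              ≡⟨ m∸n+n≡m (≤-trans α>0 (m≤m+n _ _)) ⟩
    2 * (αS + αL)                      ≡⟨ cong (2 *_) (length-count (c₀ ∷ Wc)) ⟨
    2 * length (c₀ ∷ Wc)               ∎
    where open ≡-Reasoning

  feasible : 2 * total isE (s₀ ∷ Ws) + total deficit (c₀ ∷ Wc) ≡ n + 1
  feasible = trans (cong₂ (λ e B → 2 * e + B) (total-isE (s₀ ∷ Ws)) (total-deficit (c₀ ∷ Wc)))
    (trans (sym (+-assoc (2 * βE) (3 * αS) (4 * αL))) sum≡)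

  open FeasiblePair n 2≤n s₀ Ws c₀ Wc balance feasible
  open TickerTape n 2≤n tape tape-sparse tape-sparseₙ₋₁ tape-sparseₙ tape-maximal
  open Steps (Tape row) Tape-row
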